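{- Let $a\le b$ be positive integers, let $S_{a,b}$ be the double star and let $m=a+b+1$ be its number of edges. Define \[ \tau_0=\left\lfloor(1+\sqrt{2})\left(m-\tfrac{3}{2}\right)\right\rfloor-1 \quad\text{and}\quad \tau_i=2m+i\ \text{ for } 1\le i\le 6. \] Then \[ \tau(S_{a,b})=\begin{cases} \min\{\tau_0,\tau_1\}, & 1\le a\le 2,\\ \min\{\tau_0,\tau_{a-1}\}, & 2\le a\le 6,\\ \min\{\tau_0,\tau_5\}, & a=7 \text{ and } b\le 21,\\ \min\{\tau_0,\tau_6\}, & a=7 \text{ and } b\ge 22, \text{ or } a\ge 8. \end{cases} \]
   Context: All graphs are simple. For a graph $G$ with $m$ edges, an antimagic labeling is a bijection $f:E(G)\to\{1,2,\dots,m\}$ such that the vertex sums $\phi(v)=\sum_{e\ni v} f(e)$, $v\in V(G)$, are pairwise distinct; $G$ is antimagic if it has an antimagic labeling. $G+H$ denotes the disjoint union of $G$ and $H$, and $cG$ the disjoint union of $c$ copies of $G$. $P_3$ is the path on 3 vertices. The double star $S_{a,b}$ is the tree consisting of one edge $xy$ (the internal edge) together with $a$ pendant edges attached at $x$ and $b$ pendant edges attached at $y$. For a graph $G$, $\tau(G)$ is the maximum integer such that $G+cP_3$ is antimagic for every integer $c$ with $0\le c\le \tau(G)$ (and $\tau(G)=-\infty$ if $G$ is not antimagic). -}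

module Defs where

open import Data.Nat using (ℕ; zero; suc; _+_; _*_; _∸_; _≤_; _≤ᵇ_; _/_; _⊓_)
open import Data.Bool using (Bool; true; false; if_then_else_; _∨_)
open import Data.Fin using (Fin; zero; suc; toℕ; _↑ˡ_; _↑ʳ_; splitAt; _≟_)
open import Data.Product using (_×_; _,_; proj₁; proj₂; Σ)
open import Data.Sum using (inj₁; inj₂)
open import Function.Bundles using (_⤖_; Bijection)
open import Relation.Binary.PropositionalEquality using (_≡_; _≢_)
open import Relation.Nullary using (¬_; does)

-- Finite graphs given by an indexed edge list.
-- Vertices are Fin n, edges are indexed by Fin m, each edge is a pair of
-- endpoints.  (All concrete graphs built below are simple.)

record Graph : Set where
  field
    nV    : ℕ
    nE    : ℕ
    edge  : Fin nE → Fin nV × Fin nV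
open Graph public

sumFin : (k : ℕ) → (Fin k → ℕ) → ℕ
sumFin zero    g = 0
sumFin (suc k) g = g zero + sumFin k (λ i → g (suc i))

incident : {n : ℕ} → Fin n → Fin n × Fin n → Bool
incident v (x , y) = does (v ≟ x) ∨ does (v ≟ y)

vertexSum : (G : Graph) → (Fin (nE G) → Fin (nE G)) → Fin (nV G) → ℕ
vertexSum G f v =
  sumFin (nE G) (λ e → if incident v (edge G e) then suc (toℕ (f e)) else 0)

-- antimagic labeling: a bijection E → {1..m} (encoded as Fin m via +1)
-- with pairwise distinct vertex sums
IsAntimagicLabeling : (G : Graph) → (Fin (nE G) ⤖ Fin (nE G)) → Set
IsAntimagicLabeling G f =
  ∀ u v → u ≢ v → vertexSum G (Bijection.to f) u ≢ vertexSum G (Bijection.to f) v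

Antimagic : Graph → Set
Antimagic G = Σ (Fin (nE G) ⤖ Fin (nE G)) (IsAntimagicLabeling G)

_⊕_ : Graph → Graph → Graph
G ⊕ H = record
  { nV = nV G + nV H
  ; nE = nE G + nE H
  ; edge = λ e → go (splitAt (nE G) e)
  }
  where
  go : _ → Fin (nV G + nV H) × Fin (nV G + nV H)
  go (inj₁ e) = (proj₁ (edge G e) ↑ˡ nV H) , (proj₂ (edge G e) ↑ˡ nV H)
  go (inj₂ e) = (nV G ↑ʳ proj₁ (edge H e)) , (nV G ↑ʳ proj₂ (edge H e))

emptyGraph : Graph
emptyGraph = record { nV = 0 ; nE = 0 ; edge = λ () }

copies : ℕ → Graph → Graph
copies zero    G = emptyGraph
copies (suc c) G = G ⊕ copies c G

P3 : Graph
P3 = record { nV = 3 ; nE = 2 ; edge = e }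
  where
  e : Fin 2 → Fin 3 × Fin 3
  e zero       = zero , suc zero
  e (suc zero) = suc zero , suc (suc zero)

-- double star S_{a,b}: x = vertex 0, y = vertex 1, internal edge xy,
-- a leaves 2..a+1 attached to x, b leaves a+2..a+b+1 attached to y.
DoubleStar : ℕ → ℕ → Graph
DoubleStar a b = record { nV = suc (suc (a + b)) ; nE = suc (a + b) ; edge = e }
  where
  V = Fin (suc (suc (a + b)))
  leafEdge : Fin (a + b) → V × V
  leafEdge i with splitAt a i
  ... | inj₁ j = zero , suc (suc (j ↑ˡ b))
  ... | inj₂ k = suc zero , suc (suc (a ↑ʳ k))
  e : Fin (suc (a + b)) → V × V
  e zero    = zero , suc zero
  e (suc i) = leafEdge i

-- τ(G) = t  (for t a natural number): G + cP3 antimagic for all 0 ≤ c ≤ t,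
-- and G + (t+1)P3 not antimagic.  This is exactly "t is the maximum
-- integer such that G + cP3 is antimagic for every 0 ≤ c ≤ t".

TauIs : Graph → ℕ → Set
TauIs G t =
  (∀ c → c ≤ t → Antimagic (G ⊕ copies c P3)) × ¬ Antimagic (G ⊕ copies (suc t) P3)

isqrt : ℕ → ℕ
isqrt zero    = 0
isqrt (suc n) = step (isqrt n)
  where
  step : ℕ → ℕ
  step s = if (suc s * suc s) ≤ᵇ suc n then suc s else s

-- τ_0 = ⌊(1+√2)(m - 3/2)⌋ - 1.  With k = 2m - 3 (≥ 0 as m ≥ 3):
-- (1+√2)(m-3/2) = (k + k√2)/2, ⌊k√2⌋ = isqrt(2k²), and
-- ⌊(k + y)/2⌋ = ⌊(k + ⌊y⌋)/2⌋ for integer k, real y ≥ 0.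
tau0 : ℕ → ℕ
tau0 m = let k = 2 * m ∸ 3 in ((k + isqrt (2 * k * k)) / 2) ∸ 1

tauI : ℕ → ℕ → ℕ
tauI m i = 2 * m + i

{-# OPTIONS --safe #-}
module Submission where

-- Write m = a + b + 1 and M = m + 2c for the number of labels, z for the label of the internal edge
-- xy, and A, B for the labels of the leaf edges at x and y.  Every label but z is a leaf sum, so each
-- of the c path centres has sum z or more than M, and at most one of them has sum z; the sums at x
-- and y exceed M.
--
-- Upper bound.  If p + q = z is the sum of a path centre, compare the total M(M+1)/2 of the labels
-- with the least possible sums of distinct integers.  This gives three inequalities: from x, y and
-- the other centres (whence τ₀), from A ∪ B ∪ {z, p, q} and the other centres (whence 2m + 6), and
-- from B ∪ {p, q}, x and the other centres (whence 2m + a - 1).  If no centre has sum z, then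
-- c ≤ 2m + 1.
--
-- Lower bound.  Give 1 and z - 1 to one path, so that its centre has sum z.  The other paths pair
-- four blocks L₁ < L₂ < H₁ < H₂ of consecutive integers, L₁ with H₂ and L₂ with H₁; the two
-- families of sums are arithmetic progressions of difference 2 and opposite parity.  The gaps
-- between the blocks hold the few large labels needed in A.  For a + b ≥ 38 there is an explicit
-- choice of the blocks, of A and of B; for smaller stars a search finds one.

open import Defs
import Algebra.Solver.CommutativeMonoid as CommutativeMonoidSolver
open import Data.Bool using (Bool; true; false; if_then_else_; not; _∨_; _∧_; T)
open import Data.Bool.ListAction using (any; and)
open import Data.Bool.Properties using (T-∧; T-∨)
open import Data.Empty using (⊥)
open import Data.Fin as Fin using (Fin; toℕ; fromℕ<; _↑ˡ_; _↑ʳ_; splitAt)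
import Data.Fin.Properties as Fin
open import Data.List using (List; []; _∷_; _++_; length; map; tabulate; lookup; take; drop; reverse; concatMap; downFrom; filterᵇ)
open import Data.List.Membership.Propositional using (_∈_; _∉_)
open import Data.List.Membership.Propositional.Properties using (∈-tabulate⁻; ∈-tabulate⁺; ∈-∃++; ∈-map⁻; ∈-++⁻)
open import Data.List.Membership.Propositional.Properties.WithK using (unique∧set⇒bag)
open import Data.List.Properties using (++-assoc; ++-identityʳ; length-++; length-map; map-++; length-tabulate; tabulate-cong; tabulate-lookup)
open import Data.List.Relation.Binary.BagAndSetEquality using (∼bag⇒↭)
open import Data.List.Relation.Binary.Disjoint.Propositional using (Disjoint)
open import Data.List.Relation.Binary.Permutation.Propositional hiding (refl; trans)
open import Data.List.Relation.Binary.Permutation.Propositional.Properties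
  using (↭-length; shift; shifts; ++⁺; ++⁺ˡ; ++⁺ʳ; All-resp-↭; ∈-resp-↭; map⁺; ++-comm; ↭-reverse; ++-commutativeMonoid)
import Data.List.Relation.Binary.Permutation.Setoid.Properties as Permutation
open import Data.List.Relation.Unary.All as All using (All; []; _∷_)
import Data.List.Relation.Unary.All.Properties as All
open import Data.List.Relation.Unary.AllPairs using ([]; _∷_)
open import Data.List.Relation.Unary.Any as Any using (here; there; satisfied)
open import Data.List.Relation.Unary.Any.Properties using (any⁺; any⁻)
open import Data.List.Relation.Unary.Unique.Propositional using (Unique)
import Data.List.Relation.Unary.Unique.Propositional.Properties as Unique
open import Data.Maybe as Maybe using (Maybe; just; nothing)
open import Data.Nat
open import Data.Nat.DivMod using (m/n*n≤m; m≥n⇒m/n>0; m≡m%n+[m/n]*n; m%n<n)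
open import Data.Nat.ListAction using (sum)
open import Data.Nat.ListAction.Properties using (sum-++; sum-↭)
open import Data.Nat.Properties
open import Data.Nat.Tactic.RingSolver using (solve-∀)
open import Data.List.Membership.DecPropositional _≟_ using (_∈?_)
open import Data.Product using (∃; _×_; _,_; proj₁; proj₂)
open import Data.Sum using (_⊎_; inj₁; inj₂; [_,_]′)
open import Function using (_∘_)
open import Function.Bundles using (_⤖_; mk⤖; mk⇔; Bijection; Equivalence)
open import Relation.Binary.PropositionalEquality hiding ([_])
import Relation.Binary.PropositionalEquality.Properties as ≡
open import Relation.Nullary using (¬_; Dec; does; yes; no; contradiction)
open import Relation.Nullary.Decidable using (does-⇔; dec-false; ⌊_⌋; toWitness; _×-dec_)

-- Put c = 2m + i. With M = m + 2c the bound without a centre of sum z reads c(c - 2m - 1) ≤ 0, the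
-- one from A ∪ B ∪ {z, p, q} reads (c - 1)(c - 2m - 6) ≤ 0, and the one from B ∪ {p, q} reads 2m(i
-- - a) + i(i - 1) + (a - 1)(a - 2) ≤ 0. The last fails at i = a ≥ 2; for a = 7 and i = 6 it says m
-- ≥ 30, hence the exception b ≤ 21. These bounds also dictate the constructions near c = 2m + 6. If
-- the c - 1 other centres have the sums M + 1, ..., M + c - 1, the m + 2 labels outside their paths
-- exceed 1 + ... + (m + 2) in total by (c - 1)(2m + 6 - c)/2. For c = 2m + 6 they must be 1, ..., m
-- + 2; for c = 2m + 5, 2m + 4, 2m + 3 it is enough to move m + 2 up to 2m + 4, 3m + 5, 4m + 5,
-- which is the hole of the layout. The centres end near 7m, while z, the hole and the top labels
-- given to x add up to about 8m, so x lies above them once m is large. The bound 38 on a + b is a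
-- common point from which the estimates of all the families hold.

private module ListSolver = CommutativeMonoidSolver (++-commutativeMonoid {A = ℕ})

-- Vertex sums

module VertexSums where

  open import Data.Fin using (zero; suc)

  sumFin-cong : ∀ n {f g : Fin n → ℕ} → f ≗ g → sumFin n f ≡ sumFin n g
  sumFin-cong zero    f≗g = refl
  sumFin-cong (suc n) f≗g = cong₂ _+_ (f≗g zero) (sumFin-cong n (f≗g ∘ suc))

  sumFin-zero : ∀ n → sumFin n (λ _ → 0) ≡ 0
  sumFin-zero zero    = refl
  sumFin-zero (suc n) = sumFin-zero n

  sumFin-+ : ∀ m n (f : Fin (m + n) → ℕ) →
    sumFin (m + n) f ≡ sumFin m (f ∘ (_↑ˡ n)) + sumFin n (f ∘ (m ↑ʳ_))
  sumFin-+ zero    n f = refl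
  sumFin-+ (suc m) n f =
    trans (cong (f zero +_) (sumFin-+ m n (f ∘ suc)))
          (sym (+-assoc (f zero) (sumFin m (λ i → f (suc (i ↑ˡ n)))) _))

  sumFin-tabulate : ∀ n (f : Fin n → ℕ) → sumFin n f ≡ sum (tabulate f)
  sumFin-tabulate zero    f = refl
  sumFin-tabulate (suc n) f = cong (f zero +_) (sumFin-tabulate n (f ∘ suc))

  sumFin-select : ∀ n (f : Fin n → ℕ) k →
    sumFin n (λ i → if does (k Fin.≟ i) then f i else 0) ≡ f k
  sumFin-select (suc n) f zero    = trans (cong (f zero +_) (sumFin-zero n)) (+-identityʳ _)
  sumFin-select (suc n) f (suc k) = sumFin-select n (f ∘ suc) k

  tabulate-+ : ∀ {A : Set} m n (f : Fin (m + n) → A) →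
    tabulate f ≡ tabulate (f ∘ (_↑ˡ n)) ++ tabulate (f ∘ (m ↑ʳ_))
  tabulate-+ zero    n f = refl
  tabulate-+ (suc m) n f = cong (f zero ∷_) (tabulate-+ m n (f ∘ suc))

  -- Vertex sums for arbitrary edge weights; vertexSum G f is the case e ↦ suc (toℕ (f e)).
  weightSum : (G : Graph) → (Fin (nE G) → ℕ) → Fin (nV G) → ℕ
  weightSum G w v = sumFin (nE G) (λ e → if incident v (edge G e) then w e else 0)

  weightSums : (G : Graph) → (Fin (nE G) → ℕ) → List ℕ
  weightSums G w = tabulate (weightSum G w)

  does-≟-injective : ∀ {m n} {f : Fin m → Fin n} → (∀ {x y} → f x ≡ f y → x ≡ y) →
    ∀ x y → does (f x Fin.≟ f y) ≡ does (x Fin.≟ y)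
  does-≟-injective inj x y = does-⇔ (mk⇔ inj (cong _)) (_ Fin.≟ _) (x Fin.≟ y)

  ↑ˡ≢↑ʳ : ∀ {m n} (i : Fin m) (j : Fin n) → i ↑ˡ n ≢ m ↑ʳ j
  ↑ˡ≢↑ʳ {m} {n} i j eq with trans (sym (Fin.splitAt-↑ˡ m i n)) (trans (cong (splitAt m) eq) (Fin.splitAt-↑ʳ m n j))
  ... | ()

  module _ (G H : Graph) where

    private
      edge-↑ˡ : ∀ e → edge (G ⊕ H) (e ↑ˡ nE H) ≡ (proj₁ (edge G e) ↑ˡ nV H , proj₂ (edge G e) ↑ˡ nV H)
      edge-↑ˡ e rewrite Fin.splitAt-↑ˡ (nE G) e (nE H) = refl

      edge-↑ʳ : ∀ e → edge (G ⊕ H) (nE G ↑ʳ e) ≡ (nV G ↑ʳ proj₁ (edge H e) , nV G ↑ʳ proj₂ (edge H e))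
      edge-↑ʳ e rewrite Fin.splitAt-↑ʳ (nE G) (nE H) e = refl

      incidentˡˡ : ∀ v e → incident (v ↑ˡ nV H) (edge (G ⊕ H) (e ↑ˡ nE H)) ≡ incident v (edge G e)
      incidentˡˡ v e = trans (cong (incident (v ↑ˡ nV H)) (edge-↑ˡ e))
        (cong₂ _∨_ (does-≟-injective (Fin.↑ˡ-injective (nV H) _ _) v (proj₁ (edge G e)))
                   (does-≟-injective (Fin.↑ˡ-injective (nV H) _ _) v (proj₂ (edge G e))))

      incidentˡʳ : ∀ v e → incident (v ↑ˡ nV H) (edge (G ⊕ H) (nE G ↑ʳ e)) ≡ false
      incidentˡʳ v e = trans (cong (incident (v ↑ˡ nV H)) (edge-↑ʳ e))
        (cong₂ _∨_ (dec-false (_ Fin.≟ _) (↑ˡ≢↑ʳ v (proj₁ (edge H e))))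
                   (dec-false (_ Fin.≟ _) (↑ˡ≢↑ʳ v (proj₂ (edge H e)))))

      incidentʳˡ : ∀ v e → incident (nV G ↑ʳ v) (edge (G ⊕ H) (e ↑ˡ nE H)) ≡ false
      incidentʳˡ v e = trans (cong (incident (nV G ↑ʳ v)) (edge-↑ˡ e))
        (cong₂ _∨_ (dec-false (_ Fin.≟ _) (↑ˡ≢↑ʳ (proj₁ (edge G e)) v ∘ sym))
                   (dec-false (_ Fin.≟ _) (↑ˡ≢↑ʳ (proj₂ (edge G e)) v ∘ sym)))

      incidentʳʳ : ∀ v e → incident (nV G ↑ʳ v) (edge (G ⊕ H) (nE G ↑ʳ e)) ≡ incident v (edge H e)
      incidentʳʳ v e = trans (cong (incident (nV G ↑ʳ v)) (edge-↑ʳ e))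
        (cong₂ _∨_ (does-≟-injective (Fin.↑ʳ-injective (nV G) _ _) v (proj₁ (edge H e)))
                   (does-≟-injective (Fin.↑ʳ-injective (nV G) _ _) v (proj₂ (edge H e))))

    weightSums-⊕ : ∀ w → weightSums (G ⊕ H) w ≡
      weightSums G (w ∘ (_↑ˡ nE H)) ++ weightSums H (w ∘ (nE G ↑ʳ_))
    weightSums-⊕ w = trans (tabulate-+ (nV G) (nV H) _) (cong₂ _++_ (tabulate-cong left) (tabulate-cong right))
      where
      left : ∀ v → weightSum (G ⊕ H) w (v ↑ˡ nV H) ≡ weightSum G (w ∘ (_↑ˡ nE H)) v
      left v = trans (sumFin-+ (nE G) (nE H) _) (trans
        (cong₂ _+_ (sumFin-cong (nE G) (λ e → cong (if_then _ else 0) (incidentˡˡ v e)))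
                   (trans (sumFin-cong (nE H) (λ e → cong (if_then _ else 0) (incidentˡʳ v e))) (sumFin-zero (nE H))))
        (+-identityʳ _))
      right : ∀ v → weightSum (G ⊕ H) w (nV G ↑ʳ v) ≡ weightSum H (w ∘ (nE G ↑ʳ_)) v
      right v = trans (sumFin-+ (nE G) (nE H) _)
        (cong₂ _+_ (trans (sumFin-cong (nE G) (λ e → cong (if_then _ else 0) (incidentʳˡ v e))) (sumFin-zero (nE G)))
                   (sumFin-cong (nE H) (λ e → cong (if_then _ else 0) (incidentʳʳ v e))))

  center : ℕ × ℕ → ℕ
  center (p , q) = p + q

  flatten : List (ℕ × ℕ) → List ℕ
  flatten []             = []
  flatten ((p , q) ∷ ps) = p ∷ q ∷ flatten ps

  pathSums : List (ℕ × ℕ) → List ℕ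
  pathSums []             = []
  pathSums ((p , q) ∷ ps) = p ∷ p + q ∷ q ∷ pathSums ps

  pathWeights : ∀ c → (Fin (nE (copies c P3)) → ℕ) → List (ℕ × ℕ)
  pathWeights zero    w = []
  pathWeights (suc c) w = (w zero , w (suc zero)) ∷ pathWeights c (λ e → w (suc (suc e)))

  length-pathWeights : ∀ c w → length (pathWeights c w) ≡ c
  length-pathWeights zero    w = refl
  length-pathWeights (suc c) w = cong suc (length-pathWeights c _)

  flatten-pathWeights : ∀ c w → tabulate w ≡ flatten (pathWeights c w)
  flatten-pathWeights zero    w = refl
  flatten-pathWeights (suc c) w = cong (λ xs → w zero ∷ w (suc zero) ∷ xs) (flatten-pathWeights c _)

  weightSums-copies : ∀ c w → weightSums (copies c P3) w ≡ pathSums (pathWeights c w)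
  weightSums-copies zero    w = refl
  weightSums-copies (suc c) w = trans (weightSums-⊕ P3 (copies c P3) w)
    (cong₂ _++_
      (cong₂ _∷_ (+-identityʳ _) (cong₂ _∷_ (cong (w zero +_) (+-identityʳ _)) (cong (_∷ []) (+-identityʳ _))))
      (weightSums-copies c (λ e → w (suc (suc e)))))

  starWeights : ∀ a b → (Fin (suc (a + b)) → ℕ) → ℕ × List ℕ × List ℕ
  starWeights a b w = w zero , tabulate (λ i → w (suc (i ↑ˡ b))) , tabulate (λ j → w (suc (a ↑ʳ j)))

  starSums : ℕ → List ℕ → List ℕ → List ℕ
  starSums z A B = z + sum A ∷ z + sum B ∷ A ++ B

  module _ (a b : ℕ) where

    private
      G = DoubleStar a b

      incident-x-A : ∀ i → incident zero (edge G (suc (i ↑ˡ b))) ≡ true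
      incident-x-A i rewrite Fin.splitAt-↑ˡ a i b = refl
      incident-x-B : ∀ j → incident zero (edge G (suc (a ↑ʳ j))) ≡ false
      incident-x-B j rewrite Fin.splitAt-↑ʳ a b j = refl
      incident-y-A : ∀ i → incident (suc zero) (edge G (suc (i ↑ˡ b))) ≡ false
      incident-y-A i rewrite Fin.splitAt-↑ˡ a i b = refl
      incident-y-B : ∀ j → incident (suc zero) (edge G (suc (a ↑ʳ j))) ≡ true
      incident-y-B j rewrite Fin.splitAt-↑ʳ a b j = refl

      incident-leaf : ∀ v i → incident (suc (suc v)) (edge G (suc i)) ≡ does (v Fin.≟ i)
      -- Matching on the second equation replaces `i` by an injected index, on which both sides
      -- compute.
      incident-leaf v i with splitAt a i | Fin.join-splitAt a b i
      ... | inj₁ j | refl = refl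
      ... | inj₂ k | refl = refl

    weightSums-star : ∀ w → let (z , A , B) = starWeights a b w in
      weightSums G w ≡ starSums z A B
    weightSums-star w = cong₂ _∷_ (cong (w zero +_) x-sum) (cong₂ _∷_ (cong (w zero +_) y-sum)
      (trans (tabulate-cong leaf-sum) (tabulate-+ a b (w ∘ suc))))
      where
      x-sum : _
      x-sum = trans (sumFin-+ a b _) (trans (cong₂ _+_
        (trans (sumFin-cong a (λ i → cong (if_then w (suc (i ↑ˡ b)) else 0) (incident-x-A i))) (sumFin-tabulate a _))
        (trans (sumFin-cong b (λ j → cong (if_then w (suc (a ↑ʳ j)) else 0) (incident-x-B j))) (sumFin-zero b)))
        (+-identityʳ _))
      y-sum : _
      y-sum = trans (sumFin-+ a b _) (cong₂ _+_
        (trans (sumFin-cong a (λ i → cong (if_then w (suc (i ↑ˡ b)) else 0) (incident-y-A i))) (sumFin-zero a))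
        (trans (sumFin-cong b (λ j → cong (if_then w (suc (a ↑ʳ j)) else 0) (incident-y-B j))) (sumFin-tabulate b _)))
      leaf-sum : ∀ v → _
      leaf-sum v = trans (sumFin-cong (a + b) (λ i → cong (if_then w (suc i) else 0) (incident-leaf v i)))
                         (sumFin-select (a + b) (w ∘ suc) v)

  -- Lists of labels and the translation to antimagic labelings

  interval : ℕ → ℕ → List ℕ
  interval s zero    = []
  interval s (suc n) = suc s ∷ interval (suc s) n

  length-interval : ∀ s n → length (interval s n) ≡ n
  length-interval s zero    = refl
  length-interval s (suc n) = cong suc (length-interval (suc s) n)

  ∈-interval⁻ : ∀ {x} s n → x ∈ interval s n → s < x × x ≤ s + n
  ∈-interval⁻ s (suc n) (here refl) = ≤-refl , m<m+n s (s≤s z≤n)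
  ∈-interval⁻ {x} s (suc n) (there x∈) with ∈-interval⁻ (suc s) n x∈
  ... | s<x , x≤ = <⇒≤ s<x , subst (x ≤_) (sym (+-suc s n)) x≤

  ∈-interval⁺ : ∀ {x} s n → s < x → x ≤ s + n → x ∈ interval s n
  ∈-interval⁺ {x} s zero    s<x x≤ = contradiction (subst (x ≤_) (+-identityʳ s) x≤) (<⇒≱ s<x)
  ∈-interval⁺ {x} s (suc n) s<x x≤ with suc s ≟ x
  ... | yes refl = here refl
  ... | no  s≢x  = there (∈-interval⁺ (suc s) n (≤∧≢⇒< s<x s≢x) (subst (x ≤_) (+-suc s n) x≤))

  interval-unique : ∀ s n → Unique (interval s n)
  interval-unique s zero    = []
  interval-unique s (suc n) =
    All.tabulate (λ x∈ → <⇒≢ (proj₁ (∈-interval⁻ (suc s) n x∈))) ∷ interval-unique (suc s) n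

  interval-++ : ∀ s m n → interval s m ++ interval (s + m) n ≡ interval s (m + n)
  interval-++ s zero    n = cong (λ t → interval t n) (+-identityʳ s)
  interval-++ s (suc m) n = cong (suc s ∷_)
    (trans (cong (λ t → interval (suc s) m ++ interval t n) (+-suc s m)) (interval-++ (suc s) m n))

  -- Doubled to keep division by 2 out of the arithmetic sum; the counting bounds are doubled for
  -- the same reason.
  2*sum-interval : ∀ s n → 2 * sum (interval s n) ≡ n * (2 * s + suc n)
  2*sum-interval s zero    = refl
  2*sum-interval s (suc n) = trans (*-distribˡ-+ 2 (suc s) _)
    (trans (cong (2 * suc s +_) (2*sum-interval (suc s) n)) (lemma s n))
    where
    lemma : ∀ s n → 2 * suc s + n * (2 * suc s + suc n) ≡ suc n * (2 * s + suc (suc n))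
    lemma = solve-∀

  Unique-resp-↭ : ∀ {xs ys : List ℕ} → xs ↭ ys → Unique xs → Unique ys
  Unique-resp-↭ p = Permutation.Unique-resp-↭ (≡.setoid ℕ) (↭⇒↭ₛ p)

  unique-tabulate⁻ : ∀ {n} {f : Fin n → ℕ} → Unique (tabulate f) → ∀ {i j} → f i ≡ f j → i ≡ j
  unique-tabulate⁻ (f0∉ ∷ u) {zero}  {zero}  eq = refl
  unique-tabulate⁻ (f0∉ ∷ u) {zero}  {suc j} eq = contradiction eq (All.tabulate⁻ f0∉ j)
  unique-tabulate⁻ (f0∉ ∷ u) {suc i} {zero}  eq = contradiction (sym eq) (All.tabulate⁻ f0∉ i)
  unique-tabulate⁻ (f0∉ ∷ u) {suc i} {suc j} eq = cong suc (unique-tabulate⁻ u eq)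

  -- A labeling by lists, so that unions of labels become concatenations and bijectivity becomes a
  -- permutation of 1, ..., M.
  record Labeling (a b c : ℕ) : Set where
    field
      z         : ℕ
      A B       : List ℕ
      paths     : List (ℕ × ℕ)
      length-A  : length A ≡ a
      length-B  : length B ≡ b
      length-ps : length paths ≡ c
      labels    : (z ∷ A ++ B) ++ flatten paths ↭ interval 0 (suc (a + b) + c * 2)
      distinct  : Unique (starSums z A B ++ pathSums paths)

  nE-copies : ∀ c → nE (copies c P3) ≡ c * 2
  nE-copies zero    = refl
  nE-copies (suc c) = cong (2 +_) (nE-copies c)

  module _ (a b c : ℕ) where

    private
      G = DoubleStar a b ⊕ copies c P3

    tabulate-weights : ∀ (w : Fin (nE G) → ℕ) →
      let (z , A , B) = starWeights a b (λ e → w (e ↑ˡ nE (copies c P3))) in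
      tabulate w ≡ (z ∷ A ++ B) ++ flatten (pathWeights c (λ e → w (suc (a + b) ↑ʳ e)))
    tabulate-weights w = trans (tabulate-+ (suc (a + b)) (nE (copies c P3)) w)
      (cong₂ _++_ (cong (w zero ∷_) (tabulate-+ a b (λ i → w (suc i ↑ˡ nE (copies c P3)))))
                  (flatten-pathWeights c (λ e → w (suc (a + b) ↑ʳ e))))

    weightSums-G : ∀ (w : Fin (nE G) → ℕ) →
      let (z , A , B) = starWeights a b (λ e → w (e ↑ˡ nE (copies c P3))) in
      weightSums G w ≡ starSums z A B ++ pathSums (pathWeights c (λ e → w (suc (a + b) ↑ʳ e)))
    weightSums-G w = trans (weightSums-⊕ (DoubleStar a b) (copies c P3) w)
      (cong₂ _++_ (weightSums-star a b (λ e → w (e ↑ˡ nE (copies c P3))))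
                  (weightSums-copies c (λ e → w (suc (a + b) ↑ʳ e))))

    antimagic⇒labeling : Antimagic G → Labeling a b c
    antimagic⇒labeling (f , antimagic) = record
      { z         = w zero
      ; A         = tabulate (λ i → w (suc (i ↑ˡ b) ↑ˡ nE (copies c P3)))
      ; B         = tabulate (λ j → w (suc (a ↑ʳ j) ↑ˡ nE (copies c P3)))
      ; paths     = pathWeights c (λ e → w (suc (a + b) ↑ʳ e))
      ; length-A  = length-tabulate (λ i → w (suc (i ↑ˡ b) ↑ˡ nE (copies c P3)))
      ; length-B  = length-tabulate (λ j → w (suc (a ↑ʳ j) ↑ˡ nE (copies c P3)))
      ; length-ps = length-pathWeights c _
      -- Two lists without repetitions and with the same elements are permutations of each other.
      ; labels    = subst₂ _↭_ (tabulate-weights w) (cong (λ e → interval 0 (suc (a + b) + e)) (nE-copies c))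
                      (∼bag⇒↭ (unique∧set⇒bag (Unique.tabulate⁺ w-injective) (interval-unique 0 (nE G)) (mk⇔ to from)))
      ; distinct  = subst Unique (weightSums-G w) (Unique.tabulate⁺ sum-injective)
      }
      where
      open Bijection f using () renaming (to to f⟨_⟩; injective to f-injective; strictlySurjective to f-surjective)
      w : Fin (nE G) → ℕ
      w e = suc (toℕ (f⟨ e ⟩))
      w-injective : ∀ {i j} → w i ≡ w j → i ≡ j
      w-injective = f-injective ∘ Fin.toℕ-injective ∘ suc-injective
      to : ∀ {x} → x ∈ tabulate w → x ∈ interval 0 (nE G)
      to x∈ with ∈-tabulate⁻ {f = w} x∈
      ... | i , refl = ∈-interval⁺ 0 (nE G) (s≤s z≤n) (Fin.toℕ<n f⟨ i ⟩)
      from : ∀ {x} → x ∈ interval 0 (nE G) → x ∈ tabulate w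
      from x∈ with ∈-interval⁻ 0 (nE G) x∈
      ... | s≤s {n = k} z≤n , k<n with f-surjective (fromℕ< k<n)
      ...   | i , fi≡k = subst (_∈ tabulate w) (cong suc (trans (cong toℕ fi≡k) (Fin.toℕ-fromℕ< k<n))) (∈-tabulate⁺ {f = w} i)
      sum-injective : ∀ {u v} → weightSum G w u ≡ weightSum G w v → u ≡ v
      sum-injective {u} {v} eq with u Fin.≟ v
      ... | yes u≡v = u≡v
      ... | no  u≢v = contradiction eq (antimagic u v u≢v)

    weights⇒antimagic : (w : Fin (nE G) → ℕ) → tabulate w ↭ interval 0 (nE G) →
      Unique (weightSums G w) → Antimagic G
    weights⇒antimagic w labels distinct = mk⤖ (f-injective , f-surjective) , antimagic
      where
      bounds : ∀ e → 0 < w e × w e ≤ nE G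
      bounds e = ∈-interval⁻ 0 (nE G) (∈-resp-↭ labels (∈-tabulate⁺ {f = w} e))
      pred<n : ∀ e → pred (w e) < nE G
      pred<n e with w e | bounds e
      ... | suc k | _ , k<n = k<n
      f : Fin (nE G) → Fin (nE G)
      f e = fromℕ< (pred<n e)
      suc-f : ∀ e → suc (toℕ (f e)) ≡ w e
      suc-f e = trans (cong suc (Fin.toℕ-fromℕ< (pred<n e))) (suc-pred (w e) ⦃ >-nonZero (proj₁ (bounds e)) ⦄)
      f-injective : ∀ {i j} → f i ≡ f j → i ≡ j
      f-injective {i} {j} eq = unique-tabulate⁻ (Unique-resp-↭ (↭-sym labels) (interval-unique 0 (nE G)))
        (trans (sym (suc-f i)) (trans (cong (suc ∘ toℕ) eq) (suc-f j)))
      f-surjective : ∀ y → ∃ λ x → ∀ {e} → e ≡ x → f e ≡ y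
      f-surjective y with ∈-tabulate⁻ {f = w} (∈-resp-↭ (↭-sym labels) (∈-interval⁺ 0 (nE G) (s≤s z≤n) (Fin.toℕ<n y)))
      ... | i , eq = i , λ { refl → Fin.toℕ-injective (suc-injective (trans (suc-f i) (sym eq))) }
      vertexSum-w : ∀ v → vertexSum G f v ≡ weightSum G w v
      vertexSum-w v = sumFin-cong (nE G) (λ e → cong (if incident v (edge G e) then_else 0) (suc-f e))
      antimagic : ∀ u v → u ≢ v → vertexSum G f u ≢ vertexSum G f v
      antimagic u v u≢v eq = u≢v (unique-tabulate⁻ distinct
        (trans (sym (vertexSum-w u)) (trans eq (vertexSum-w v))))

  starWeight : ∀ z (A B : List ℕ) → Fin (suc (length A + length B)) → ℕ
  starWeight z A B zero    = z
  starWeight z A B (suc i) = [ lookup A , lookup B ]′ (splitAt (length A) i)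

  starWeights-starWeight : ∀ z A B → starWeights (length A) (length B) (starWeight z A B) ≡ (z , A , B)
  starWeights-starWeight z A B = cong (z ,_) (cong₂ _,_
    (trans (tabulate-cong (λ i → cong [ lookup A , lookup B ]′ (Fin.splitAt-↑ˡ (length A) i (length B)))) (tabulate-lookup A))
    (trans (tabulate-cong (λ j → cong [ lookup A , lookup B ]′ (Fin.splitAt-↑ʳ (length A) (length B) j))) (tabulate-lookup B)))

  pathWeight : ∀ (ps : List (ℕ × ℕ)) → Fin (nE (copies (length ps) P3)) → ℕ
  pathWeight ((p , q) ∷ ps) zero          = p
  pathWeight ((p , q) ∷ ps) (suc zero)    = q
  pathWeight ((p , q) ∷ ps) (suc (suc e)) = pathWeight ps e

  pathWeights-pathWeight : ∀ (ps : List (ℕ × ℕ)) → pathWeights (length ps) (pathWeight ps) ≡ ps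
  pathWeights-pathWeight []       = refl
  pathWeights-pathWeight (p ∷ ps) = cong (p ∷_) (pathWeights-pathWeight ps)

  starWeights-cong : ∀ a b {w w′} → w ≗ w′ → starWeights a b w ≡ starWeights a b w′
  starWeights-cong a b eq = cong₂ _,_ (eq zero) (cong₂ _,_
    (tabulate-cong (λ i → eq (suc (i ↑ˡ b)))) (tabulate-cong (λ j → eq (suc (a ↑ʳ j)))))

  pathWeights-cong : ∀ c {w w′} → w ≗ w′ → pathWeights c w ≡ pathWeights c w′
  pathWeights-cong zero    eq = refl
  pathWeights-cong (suc c) eq = cong₂ _∷_ (cong₂ _,_ (eq zero) (eq (suc zero))) (pathWeights-cong c (λ e → eq (suc (suc e))))

  labeling⇒antimagic : ∀ {a b c} → Labeling a b c → Antimagic (DoubleStar a b ⊕ copies c P3)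
  labeling⇒antimagic record { z = z ; A = A ; B = B ; paths = ps ; length-A = refl ; length-B = refl
                            ; length-ps = refl ; labels = labels ; distinct = distinct } =
    weights⇒antimagic a b c w
      (subst₂ _↭_ (sym (trans (tabulate-weights a b c w)
                              (cong₂ (λ (z , A , B) ps → (z ∷ A ++ B) ++ flatten ps) star paths)))
                  (cong (λ e → interval 0 (suc (a + b) + e)) (sym (nE-copies c))) labels)
      (subst Unique (sym (trans (weightSums-G a b c w)
                                (cong₂ (λ (z , A , B) ps → starSums z A B ++ pathSums ps) star paths))) distinct)
    where
    a = length A
    b = length B
    c = length ps
    w : Fin (nE (DoubleStar a b ⊕ copies c P3)) → ℕ
    w e = [ starWeight z A B , pathWeight ps ]′ (splitAt (suc (a + b)) e)
    star : starWeights a b (λ e → w (e ↑ˡ nE (copies c P3))) ≡ (z , A , B)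
    star = trans (starWeights-cong a b λ e →
      cong [ starWeight z A B , pathWeight ps ]′ (Fin.splitAt-↑ˡ (suc (a + b)) e (nE (copies c P3))))
      (starWeights-starWeight z A B)
    paths : pathWeights c (λ e → w (suc (a + b) ↑ʳ e)) ≡ ps
    paths = trans (pathWeights-cong c λ e →
      cong [ starWeight z A B , pathWeight ps ]′ (Fin.splitAt-↑ʳ (suc (a + b)) (nE (copies c P3)) e))
      (pathWeights-pathWeight ps)

open VertexSums

-- Counting bounds

-- The left side is twice (lo + 1) + ... + (lo + n) for a list of n entries. Induction on the width
-- `h` of the range: if lo + 1 is absent, the range shrinks from below; if it is present, it is
-- removed and the other n - 1 entries exceed lo + 1.
bounded⇒minSum : ∀ h lo xs → Unique xs → All (lo <_) xs → All (_≤ lo + h) xs →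
  length xs * (2 * lo + suc (length xs)) ≤ 2 * sum xs
bounded⇒minSum zero    lo []       _ _ _ = z≤n
bounded⇒minSum zero    lo (x ∷ xs) _ (lo<x ∷ _) (x≤ ∷ _) =
  contradiction (subst (x ≤_) (+-identityʳ lo) x≤) (<⇒≱ lo<x)
bounded⇒minSum (suc h) lo xs u lo< ≤hi with suc lo ∈? xs
... | no lo∉ = ≤-trans (*-monoʳ-≤ (length xs) (+-monoˡ-≤ (suc (length xs)) (*-monoʳ-≤ 2 (n≤1+n lo))))
  (bounded⇒minSum h (suc lo) xs u
    (All.tabulate (λ x∈ → ≤∧≢⇒< (All.lookup lo< x∈) (λ { refl → lo∉ x∈ })))
    (subst (λ k → All (_≤ k) xs) (+-suc lo h) ≤hi))
... | yes lo∈ with ∈-∃++ lo∈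
...   | ys , zs , refl with shift (suc lo) ys zs
...     | p with Unique-resp-↭ p u | All-resp-↭ p lo< | All-resp-↭ p ≤hi
...       | lo∉ ∷ u′ | _ ∷ lo<′ | _ ∷ ≤hi′ = begin
  length (ys ++ suc lo ∷ zs) * (2 * lo + suc (length (ys ++ suc lo ∷ zs)))
    ≡⟨ cong (λ n → n * (2 * lo + suc n)) (↭-length p) ⟩
  suc n * (2 * lo + suc (suc n))             ≡⟨ lemma lo n ⟨
  2 * suc lo + n * (2 * suc lo + suc n)      ≤⟨ +-monoʳ-≤ (2 * suc lo) (bounded⇒minSum h (suc lo) (ys ++ zs) u′
    (All.tabulate (λ x∈ → ≤∧≢⇒< (All.lookup lo<′ x∈) (All.lookup lo∉ x∈)))
    (subst (λ k → All (_≤ k) (ys ++ zs)) (+-suc lo h) ≤hi′)) ⟩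
  2 * suc lo + 2 * sum (ys ++ zs)            ≡⟨ *-distribˡ-+ 2 (suc lo) _ ⟨
  2 * (suc lo + sum (ys ++ zs))              ≡⟨ cong (2 *_) (sum-↭ p) ⟨
  2 * sum (ys ++ suc lo ∷ zs)                ∎
  where
  open ≤-Reasoning
  n = length (ys ++ zs)
  lemma : ∀ lo n → 2 * suc lo + n * (2 * suc lo + suc n) ≡ suc n * (2 * lo + suc (suc n))
  lemma = solve-∀

∈⇒≤sum : ∀ {x xs} → x ∈ xs → x ≤ sum xs
∈⇒≤sum {xs = y ∷ ys} (here refl) = m≤m+n y (sum ys)
∈⇒≤sum {xs = y ∷ ys} (there x∈)  = ≤-trans (∈⇒≤sum x∈) (m≤n+m (sum ys) y)

-- The entries are bounded by their total, which therefore serves as the width that the induction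
-- needs.
minSum : ∀ lo xs → Unique xs → All (lo <_) xs → length xs * (2 * lo + suc (length xs)) ≤ 2 * sum xs
minSum lo xs u lo< = bounded⇒minSum (sum xs) lo xs u lo<
  (All.tabulate (λ x∈ → ≤-trans (∈⇒≤sum x∈) (m≤n+m (sum xs) lo)))

centers : List (ℕ × ℕ) → List ℕ
centers = map center

sum-flatten : ∀ ps → sum (flatten ps) ≡ sum (centers ps)
sum-flatten []             = refl
sum-flatten ((p , q) ∷ ps) = trans (cong (λ s → p + (q + s)) (sum-flatten ps)) (sym (+-assoc p q _))

pathSums-↭ : ∀ ps → pathSums ps ↭ flatten ps ++ centers ps
pathSums-↭ []             = ↭-refl
pathSums-↭ ((p , q) ∷ ps) = ↭-prep p (↭-trans (↭-prep (p + q) (↭-prep q (pathSums-↭ ps)))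
  (↭-sym (shift (p + q) (q ∷ flatten ps) (centers ps))))

flatten-↭ : ∀ {ps qs} → ps ↭ qs → flatten ps ↭ flatten qs
flatten-↭ _↭_.refl                       = ↭-refl
flatten-↭ (_↭_.prep (p , q) r)           = ↭-prep p (↭-prep q (flatten-↭ r))
flatten-↭ (_↭_.swap (p , q) (p′ , q′) r) = ↭-trans (shifts (p ∷ q ∷ []) (p′ ∷ q′ ∷ []))
  (++⁺ˡ (p′ ∷ q′ ∷ p ∷ q ∷ []) (flatten-↭ r))
flatten-↭ (_↭_.trans r s)                = ↭-trans (flatten-↭ r) (flatten-↭ s)

sums-↭ : ∀ z A B ps → starSums z A B ++ pathSums ps ↭
  (A ++ B ++ flatten ps) ++ (z + sum A ∷ z + sum B ∷ centers ps)
sums-↭ z A B ps = begin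
  z + sum A ∷ z + sum B ∷ (A ++ B) ++ pathSums ps
    ↭⟨ ++⁺ˡ (z + sum A ∷ z + sum B ∷ []) (++⁺ˡ (A ++ B) (pathSums-↭ ps)) ⟩
  z + sum A ∷ z + sum B ∷ (A ++ B) ++ flatten ps ++ centers ps
    ≡⟨ cong (λ xs → z + sum A ∷ z + sum B ∷ xs)
         (trans (++-assoc A B _) (trans (cong (A ++_) (sym (++-assoc B (flatten ps) _))) (sym (++-assoc A _ _)))) ⟩
  z + sum A ∷ z + sum B ∷ (A ++ B ++ flatten ps) ++ centers ps
    ↭⟨ shifts (z + sum A ∷ z + sum B ∷ []) (A ++ B ++ flatten ps) ⟩
  (A ++ B ++ flatten ps) ++ (z + sum A ∷ z + sum B ∷ centers ps) ∎
  where open PermutationReasoning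

unique-++⁻ : ∀ (xs : List ℕ) {ys} → Unique (xs ++ ys) → Unique xs × Unique ys × Disjoint xs ys
unique-++⁻ []       u         = [] , u , λ ()
unique-++⁻ (x ∷ xs) (x∉ ∷ u) with unique-++⁻ xs u
... | uxs , uys , disj = (All.++⁻ˡ xs x∉ ∷ uxs) , uys , λ where
  (here refl , y∈) → All.lookup (All.++⁻ʳ xs x∉) y∈ refl
  (there x∈  , y∈) → disj (x∈ , y∈)

leaves : List ℕ → List ℕ → List (ℕ × ℕ) → List ℕ
leaves A B ps = A ++ B ++ flatten ps

innerSums : ℕ → List ℕ → List ℕ → List (ℕ × ℕ) → List ℕ
innerSums z A B ps = z + sum A ∷ z + sum B ∷ centers ps

-- The leaf sums are split off from the sums at the centres, because together with z they are
-- exactly the labels.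
IsLabeling : ℕ → ℕ → List ℕ → List ℕ → List (ℕ × ℕ) → Set
IsLabeling M z A B ps =
  (z ∷ leaves A B ps ↭ interval 0 M) × Unique (leaves A B ps ++ innerSums z A B ps)

isLabeling-↭ : ∀ M z A B {ps qs} → ps ↭ qs → IsLabeling M z A B ps → IsLabeling M z A B qs
isLabeling-↭ M z A B p (labels , distinct) =
  ↭-trans (↭-prep _ (↭-sym leaves-↭)) labels ,
  Unique-resp-↭ (++⁺ leaves-↭ (↭-prep _ (↭-prep _ (map⁺ center p)))) distinct
  where
  leaves-↭ = ++⁺ˡ A (++⁺ˡ B (flatten-↭ p))

All-center-positive : ∀ ps → All (0 <_) (flatten ps) → All (0 <_) (centers ps)
All-center-positive []             _                = []
All-center-positive ((p , q) ∷ ps) (0<p ∷ _ ∷ 0<ps) = ≤-trans 0<p (m≤m+n p q) ∷ All-center-positive ps 0<ps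

sum-positive : ∀ {xs} → All (0 <_) xs → 1 ≤ length xs → 0 < sum xs
sum-positive (0<x ∷ _) _ = ≤-trans 0<x (m≤m+n _ _)

module LabelingProperties (M z : ℕ) (A B : List ℕ) (ps : List (ℕ × ℕ))
  (isLabeling : IsLabeling M z A B ps) (1≤a : 1 ≤ length A) (1≤b : 1 ≤ length B) where

  private
    labels = proj₁ isLabeling
    distinct = unique-++⁻ (leaves A B ps) (proj₂ isLabeling)

    positive : All (0 <_) (z ∷ leaves A B ps)
    positive = All-resp-↭ (↭-sym labels) (All.tabulate (λ x∈ → proj₁ (∈-interval⁻ 0 M x∈)))

    0<z = All.head positive
    0<A = All.++⁻ˡ A (All.tail positive)
    0<B = All.++⁻ˡ B (All.++⁻ʳ A (All.tail positive))
    0<ps = All.++⁻ʳ B (All.++⁻ʳ A (All.tail positive))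

    innerSum-large : ∀ {k} → k ∈ innerSums z A B ps → 0 < k → k ≢ z → M < k
    innerSum-large k∈ 0<k k≢z = ≰⇒> λ k≤M → case (∈-resp-↭ (↭-sym labels) (∈-interval⁺ 0 M 0<k k≤M))
      where
      case : _ ∈ z ∷ leaves A B ps → _
      case (here k≡z)  = k≢z k≡z
      case (there k∈′) = proj₂ (proj₂ distinct) (k∈′ , k∈)

  labels-unique : Unique (z ∷ leaves A B ps)
  labels-unique = Unique-resp-↭ (↭-sym labels) (interval-unique 0 M)

  labels-positive : All (0 <_) (z ∷ leaves A B ps)
  labels-positive = positive

  innerSums-unique : Unique (innerSums z A B ps)
  innerSums-unique = proj₁ (proj₂ distinct)

  z≤M : z ≤ M
  z≤M = proj₂ (∈-interval⁻ 0 M (∈-resp-↭ labels (here refl)))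

  x-sum-large : M < z + sum A
  x-sum-large = innerSum-large (here refl) (≤-trans 0<z (m≤m+n z _))
    (>⇒≢ (m<m+n z (sum-positive 0<A 1≤a)))

  y-sum-large : M < z + sum B
  y-sum-large = innerSum-large (there (here refl)) (≤-trans 0<z (m≤m+n z _))
    (>⇒≢ (m<m+n z (sum-positive 0<B 1≤b)))

  center-large : ∀ {k} → k ∈ centers ps → k ≢ z → M < k
  center-large k∈ = innerSum-large (there (there k∈)) (All.lookup (All-center-positive ps 0<ps) k∈)

  label-sum : 2 * (z + (sum A + (sum B + sum (centers ps)))) ≡ M * suc M
  label-sum = begin
    2 * (z + (sum A + (sum B + sum (centers ps))))
      ≡⟨ cong (λ s → 2 * (z + (sum A + (sum B + s)))) (sum-flatten ps) ⟨
    2 * (z + (sum A + (sum B + sum (flatten ps))))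
      ≡⟨ cong (λ s → 2 * (z + (sum A + s))) (sum-++ B (flatten ps)) ⟨
    2 * (z + (sum A + sum (B ++ flatten ps)))
      ≡⟨ cong (λ s → 2 * (z + s)) (sum-++ A (B ++ flatten ps)) ⟨
    2 * sum (z ∷ leaves A B ps)
      ≡⟨ cong (2 *_) (sum-↭ labels) ⟩
    2 * sum (interval 0 M)
      ≡⟨ 2*sum-interval 0 M ⟩
    M * suc M ∎
    where open ≡-Reasoning

module NoCenter (M z : ℕ) (A B : List ℕ) (ps : List (ℕ × ℕ)) (isLabeling : IsLabeling M z A B ps)
  (1≤a : 1 ≤ length A) (1≤b : 1 ≤ length B) (z∉ : z ∉ centers ps) where

  open LabelingProperties M z A B ps isLabeling 1≤a 1≤b

  private
    c = length ps
    m = suc (length A + length B)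
    large : All (M <_) (innerSums z A B ps)
    large = x-sum-large ∷ y-sum-large ∷
      All.tabulate (λ k∈ → center-large k∈ (λ { refl → z∉ k∈ }))
    SA = sum A
    SB = sum B
    SC = sum (centers ps)
    length-centers : length (centers ps) ≡ c
    length-centers = length-map center ps

  -- The sums at x, y and the c centres are c + 2 distinct values above M whose total counts z
  -- twice. The greatest of the c + 2 least possible values pays for the second z ≤ M, which leaves
  -- the same inequality as in the case of a centre with sum z.
  innerSums-bound : suc c * (2 * M + suc (suc c)) ≤ M * suc M
  innerSums-bound = +-cancelʳ-≤ (2 * M) _ _ (begin
    suc c * (2 * M + suc (suc c)) + 2 * M       ≤⟨ m≤m+n _ (c + c + 4) ⟩
    suc c * (2 * M + suc (suc c)) + 2 * M + (c + c + 4) ≡⟨ lemma₁ M c ⟩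
    suc (suc c) * (2 * M + suc (suc (suc c)))   ≡⟨ cong (λ n → suc (suc n) * (2 * M + suc (suc (suc n)))) length-centers ⟨
    length (innerSums z A B ps) * (2 * M + suc (length (innerSums z A B ps)))
      ≤⟨ minSum M (innerSums z A B ps) innerSums-unique large ⟩
    2 * (z + SA + (z + SB + SC))                ≡⟨ lemma₂ z SA SB SC ⟩
    2 * (z + (SA + (SB + SC))) + 2 * z          ≡⟨ cong (_+ 2 * z) label-sum ⟩
    M * suc M + 2 * z                           ≤⟨ +-monoʳ-≤ (M * suc M) (*-monoʳ-≤ 2 z≤M) ⟩
    M * suc M + 2 * M                           ∎)
    where
    open ≤-Reasoning
    lemma₁ : ∀ M c → suc c * (2 * M + suc (suc c)) + 2 * M + (c + c + 4) ≡ suc (suc c) * (2 * M + suc (suc (suc c)))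
    lemma₁ = solve-∀
    lemma₂ : ∀ z A B C → 2 * (z + A + (z + B + C)) ≡ 2 * (z + (A + (B + C))) + 2 * z
    lemma₂ = solve-∀

  centers-bound : c * (2 * M + suc c) + m * suc m ≤ M * suc M
  centers-bound = begin
    c * (2 * M + suc c) + m * suc m
      ≡⟨ cong₂ (λ n k → n * (2 * M + suc n) + suc k * suc (suc k)) length-centers (length-++ A) ⟨
    length (centers ps) * (2 * M + suc (length (centers ps))) + length (z ∷ A ++ B) * suc (length (z ∷ A ++ B))
      ≤⟨ +-mono-≤ (minSum M (centers ps) unique-centers (All.tail (All.tail large)))
                  (minSum 0 (z ∷ A ++ B) (proj₁ star) (All.++⁻ˡ (z ∷ A ++ B) (proj₂ star))) ⟩
    2 * SC + 2 * (z + sum (A ++ B))   ≡⟨ cong (λ s → 2 * SC + 2 * (z + s)) (sum-++ A B) ⟩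
    2 * SC + 2 * (z + (SA + SB))      ≡⟨ lemma z SA SB SC ⟩
    2 * (z + (SA + (SB + SC)))        ≡⟨ label-sum ⟩
    M * suc M                         ∎
    where
    open ≤-Reasoning
    unique-centers : Unique (centers ps)
    unique-centers = proj₁ (proj₂ (unique-++⁻ (z + SA ∷ z + SB ∷ []) innerSums-unique))
    assoc = cong (z ∷_) (sym (++-assoc A B (flatten ps)))
    star : Unique (z ∷ A ++ B) × All (0 <_) ((z ∷ A ++ B) ++ flatten ps)
    star = proj₁ (unique-++⁻ (z ∷ A ++ B) (subst Unique assoc labels-unique)) ,
           subst (All (0 <_)) assoc labels-positive
    lemma : ∀ z A B C → 2 * C + 2 * (z + (A + B)) ≡ 2 * (z + (A + (B + C)))
    lemma = solve-∀

module WithCenter (M p q : ℕ) (A B : List ℕ) (ps : List (ℕ × ℕ))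
  (isLabeling : IsLabeling M (p + q) A B ((p , q) ∷ ps)) (1≤a : 1 ≤ length A) (1≤b : 1 ≤ length B) where

  open LabelingProperties M (p + q) A B ((p , q) ∷ ps) isLabeling 1≤a 1≤b

  private
    z = p + q
    c = suc (length ps)
    m = suc (length A + length B)
    SA = sum A
    SB = sum B
    SC = sum (centers ps)
    length-centers : length (centers ps) ≡ length ps
    length-centers = length-map center ps
    inner-↭ : innerSums z A B ((p , q) ∷ ps) ↭ z ∷ innerSums z A B ps
    inner-↭ = shift z (z + SA ∷ z + SB ∷ []) (centers ps)
    unique-z∷inner = Unique-resp-↭ inner-↭ innerSums-unique
    unique-inner : Unique (innerSums z A B ps)
    unique-inner with unique-z∷inner
    ... | _ ∷ u = u
    z≢ : All (z ≢_) (innerSums z A B ps)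
    z≢ with unique-z∷inner
    ... | z≢ ∷ _ = z≢
    large : All (M <_) (innerSums z A B ps)
    large = x-sum-large ∷ y-sum-large ∷
      All.tabulate (λ k∈ → center-large (there k∈) (λ { refl → All.lookup z≢ (there (there k∈)) refl }))
    unique-centers : Unique (centers ps)
    unique-centers = proj₁ (proj₂ (unique-++⁻ (z + SA ∷ z + SB ∷ []) unique-inner))
    labels-↭ : z ∷ leaves A B ((p , q) ∷ ps) ↭ (A ++ z ∷ p ∷ q ∷ B) ++ flatten ps
    labels-↭ = begin
      z ∷ A ++ B ++ p ∷ q ∷ flatten ps       ↭⟨ shift z A _ ⟨
      A ++ z ∷ B ++ p ∷ q ∷ flatten ps       ↭⟨ ++⁺ˡ A (↭-prep z (shifts B (p ∷ q ∷ []))) ⟩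
      A ++ z ∷ p ∷ q ∷ B ++ flatten ps       ≡⟨ ++-assoc A (z ∷ p ∷ q ∷ B) (flatten ps) ⟨
      (A ++ z ∷ p ∷ q ∷ B) ++ flatten ps     ∎
      where open PermutationReasoning
    unique-low : Unique (A ++ z ∷ p ∷ q ∷ B)
    unique-low = proj₁ (unique-++⁻ _ (Unique-resp-↭ labels-↭ labels-unique))
    positive-low : All (0 <_) (A ++ z ∷ p ∷ q ∷ B)
    positive-low = All.++⁻ˡ _ (All-resp-↭ labels-↭ labels-positive)

  -- Since z = p + q, the second z in the sums at x and y stands for the labels p and q of the path
  -- left out, so these c + 1 sums add up to all the labels exactly.
  innerSums-bound : suc c * (2 * M + suc (suc c)) ≤ M * suc M
  innerSums-bound = begin
    suc c * (2 * M + suc (suc c))   ≡⟨ cong (λ n → suc (suc n) * (2 * M + suc (suc (suc n)))) length-centers ⟨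
    length (innerSums z A B ps) * (2 * M + suc (length (innerSums z A B ps)))
                                    ≤⟨ minSum M (innerSums z A B ps) unique-inner large ⟩
    2 * (z + SA + (z + SB + SC))    ≡⟨ lemma z SA SB SC ⟩
    2 * (z + (SA + (SB + (z + SC)))) ≡⟨ label-sum ⟩
    M * suc M                       ∎
    where
    open ≤-Reasoning
    lemma : ∀ z A B C → 2 * (z + A + (z + B + C)) ≡ 2 * (z + (A + (B + (z + C))))
    lemma = solve-∀

  star-bound : length ps * (2 * M + c) + suc (suc m) * suc (suc (suc m)) ≤ M * suc M
  star-bound = begin
    length ps * (2 * M + c) + suc (suc m) * suc (suc (suc m))
      ≡⟨ cong₂ (λ n k → n * (2 * M + suc n) + k * suc k) length-centers length-low ⟨
    length (centers ps) * (2 * M + suc (length (centers ps))) + length (A ++ z ∷ p ∷ q ∷ B) * suc (length (A ++ z ∷ p ∷ q ∷ B))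
      ≤⟨ +-mono-≤ (minSum M (centers ps) unique-centers (All.tail (All.tail large)))
                  (minSum 0 (A ++ z ∷ p ∷ q ∷ B) unique-low positive-low) ⟩
    2 * SC + 2 * sum (A ++ z ∷ p ∷ q ∷ B) ≡⟨ cong (λ s → 2 * SC + 2 * s) (sum-++ A (z ∷ p ∷ q ∷ B)) ⟩
    2 * SC + 2 * (SA + (z + (p + (q + SB)))) ≡⟨ lemma p q SA SB SC ⟩
    2 * (z + (SA + (SB + (z + SC))))      ≡⟨ label-sum ⟩
    M * suc M                             ∎
    where
    open ≤-Reasoning
    length-low : length (A ++ z ∷ p ∷ q ∷ B) ≡ suc (suc m)
    length-low = trans (length-++ A) (trans (+-suc _ _) (cong suc (trans (+-suc _ _) (cong suc (+-suc _ _)))))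
    lemma : ∀ p q A B C → 2 * C + 2 * (A + (p + q + (p + (q + B)))) ≡ 2 * (p + q + (A + (B + (p + q + C))))
    lemma = solve-∀

  -- Each label is again counted once. The sum at x enters as one value above M, where `star-bound`
  -- counts z and the labels in A as small numbers; the fewer labels A has, the more this gains.
  y-star-bound : c * (2 * M + suc c) + suc (suc (length B)) * suc (suc (suc (length B))) ≤ M * suc M
  y-star-bound = begin
    c * (2 * M + suc c) + suc (suc (length B)) * suc (suc (suc (length B)))
      ≡⟨ cong (λ n → suc n * (2 * M + suc (suc n)) + suc (suc (length B)) * suc (suc (suc (length B)))) length-centers ⟨
    length (z + SA ∷ centers ps) * (2 * M + suc (length (z + SA ∷ centers ps))) +
    length (p ∷ q ∷ B) * suc (length (p ∷ q ∷ B))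
      ≤⟨ +-mono-≤ (minSum M (z + SA ∷ centers ps) unique-x (All.head large ∷ All.tail (All.tail large)))
                  (minSum 0 (p ∷ q ∷ B) unique-pqB positive-pqB) ⟩
    2 * (z + SA + SC) + 2 * (p + (q + SB)) ≡⟨ lemma p q SA SB SC ⟩
    2 * (z + (SA + (SB + (z + SC))))       ≡⟨ label-sum ⟩
    M * suc M                              ∎
    where
    open ≤-Reasoning
    unique-x : Unique (z + SA ∷ centers ps)
    unique-x with unique-inner
    ... | (_ ∷ x≢) ∷ _ ∷ u = x≢ ∷ u
    unique-pqB : Unique (p ∷ q ∷ B)
    unique-pqB with proj₁ (proj₂ (unique-++⁻ A unique-low))
    ... | _ ∷ u = u
    positive-pqB : All (0 <_) (p ∷ q ∷ B)
    positive-pqB = All.tail (All.++⁻ʳ A positive-low)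
    lemma : ∀ p q A B C → 2 * (p + q + A + C) + 2 * (p + (q + B)) ≡ 2 * (p + q + (A + (B + (p + q + C))))
    lemma = solve-∀

-- The counting bounds as inequalities in m and c

InnerBound : ℕ → ℕ → Set
InnerBound m c = let M = m + c * 2 in suc c * (2 * M + suc (suc c)) ≤ M * suc M

CenterBound : ℕ → ℕ → Set
CenterBound m c = let M = m + c * 2 in c * (2 * M + suc c) + m * suc m ≤ M * suc M

-- `pred c` counts the paths other than the one whose centre has sum z, and m + 2 the labels of the
-- star together with p and q.
StarBound : ℕ → ℕ → Set
StarBound m c = let M = m + c * 2 in pred c * (2 * M + c) + suc (suc m) * suc (suc (suc m)) ≤ M * suc M

LeafBound : ℕ → ℕ → ℕ → Set
LeafBound b m c = let M = m + c * 2 in c * (2 * M + suc c) + suc (suc b) * suc (suc (suc b)) ≤ M * suc M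

OuterBound : ℕ → ℕ → ℕ → Set
OuterBound b m c = CenterBound m c ⊎ StarBound m c × LeafBound b m c

isLabeling⇒bounds : ∀ z A B ps → 1 ≤ length A → 1 ≤ length B →
  IsLabeling (suc (length A + length B) + length ps * 2) z A B ps →
  InnerBound (suc (length A + length B)) (length ps) × OuterBound (length B) (suc (length A + length B)) (length ps)
isLabeling⇒bounds z A B ps 1≤a 1≤b isLabeling with z ∈? centers ps
... | no  z∉ = innerSums-bound , inj₁ centers-bound
  where open NoCenter _ z A B ps isLabeling 1≤a 1≤b z∉
... | yes z∈ with ∈-map⁻ center z∈
...   | (p , q) , pq∈ , refl with ∈-∃++ pq∈
-- The path whose centre has sum z is brought to the front, as `WithCenter` requires; the length
-- equation keeps the number of paths in step.
...     | ys , zs , refl with ↭-length (shift (p , q) ys zs) | isLabeling-↭ _ (p + q) A B (shift (p , q) ys zs) isLabeling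
...       | eq | isLabeling′ rewrite eq = innerSums-bound , inj₂ (star-bound , y-star-bound)
  where open WithCenter _ p q A B (ys ++ zs) isLabeling′ 1≤a 1≤b

labeling⇒bounds : ∀ {a b c} → 1 ≤ a → 1 ≤ b → Labeling a b c → InnerBound (suc (a + b)) c × OuterBound b (suc (a + b)) c
labeling⇒bounds 1≤a 1≤b record { z = z ; A = A ; B = B ; paths = ps ; length-A = refl ; length-B = refl
                               ; length-ps = refl ; labels = labels ; distinct = distinct } =
  isLabeling⇒bounds z A B ps 1≤a 1≤b
    ( subst (λ xs → z ∷ xs ↭ interval 0 (suc (length A + length B) + length ps * 2)) (++-assoc A B (flatten ps)) labels
    , Unique-resp-↭ (sums-↭ z A B ps) distinct)

-- No labelling beyond τ

isqrt-spec : ∀ n → isqrt n * isqrt n ≤ n × n < suc (isqrt n) * suc (isqrt n)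
isqrt-spec zero = z≤n , s≤s z≤n
isqrt-spec (suc n) with isqrt n | isqrt-spec n
... | s | s²≤n , n<s² with (suc s * suc s) ≤ᵇ suc n in eq
...   | true  = ≤ᵇ⇒≤ (suc s * suc s) (suc n) (subst T (sym eq) _) , <-≤-trans (s≤s n<s²)
  (≤-trans (m≤m+n _ (s + s + 2)) (≤-reflexive (lemma s)))
  where
  lemma : ∀ s → suc (suc s * suc s) + (s + s + 2) ≡ suc (suc s) * suc (suc s)
  lemma = solve-∀
...   | false = m≤n⇒m≤1+n s²≤n , ≰⇒> (λ le → subst T eq (≤⇒≤ᵇ le))

-- With m = 3 + n, the k below is 2 m ∸ 3 as tau0 unfolds it.  In terms of D = 1 + 2 e = 2 (c + 1) - k,
-- the bound InnerBound m c reads D² < 2 k².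
module InnerBoundSquare (n e : ℕ) where

  k = n + (3 + n + 0)
  c = suc n + e

  identity : 4 * (suc c * (2 * (3 + n + c * 2) + suc (suc c))) + 2 * k * k ≡
    4 * ((3 + n + c * 2) * suc (3 + n + c * 2)) + suc (suc (2 * e) * suc (2 * e))
  identity = lemma n e
    where
    lemma : ∀ n e → 4 * (suc (suc n + e) * (2 * (3 + n + (suc n + e) * 2) + suc (suc (suc n + e)))) +
      2 * (n + (3 + n + 0)) * (n + (3 + n + 0)) ≡
      4 * ((3 + n + (suc n + e) * 2) * suc (3 + n + (suc n + e) * 2)) + suc (suc (2 * e) * suc (2 * e))
    lemma = solve-∀

  innerBound⇒square : InnerBound (3 + n) c → suc (2 * e) * suc (2 * e) < 2 * k * k
  innerBound⇒square bound = +-cancelˡ-≤ (4 * ((3 + n + c * 2) * suc (3 + n + c * 2))) _ _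
    (≤-trans (≤-reflexive (sym identity)) (+-monoˡ-≤ (2 * k * k) (*-monoʳ-≤ 4 bound)))

  square⇒innerBound : suc (2 * e) * suc (2 * e) < 2 * k * k → InnerBound (3 + n) c
  square⇒innerBound square = *-cancelˡ-≤ 4 (+-cancelʳ-≤ (2 * k * k) _ _
    (≤-trans (≤-reflexive identity) (+-monoʳ-≤ (4 * ((3 + n + c * 2) * suc (3 + n + c * 2))) square)))

module _ (n : ℕ) where

  private
    k = n + (3 + n + 0)
    s = isqrt (2 * k * k)
    q = (k + s) / 2
    q>0 : 0 < q
    q>0 = m≥n⇒m/n>0 (≤-trans (≤-trans (s≤s (s≤s z≤n)) (m≤n+m (3 + n + 0) n)) (m≤m+n k s))

  -- For c ≤ n the difference 2(c + 1) - k is negative and the bound holds with an explicit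
  -- polynomial slack. For c = n + 1 + e, `tau0` gives D ≤ s, hence D² ≤ 2k²; equality is impossible
  -- because D is odd.
  ≤tau0⇒innerBound : ∀ c → c ≤ tau0 (3 + n) → InnerBound (3 + n) c
  ≤tau0⇒innerBound c c≤ with suc n ≤? c
  ... | no  c≰ with m≤n⇒∃[o]m+o≡n (≤-pred (≰⇒> c≰))
  ...   | d , refl = ≤-trans (m≤m+n _ _) (≤-reflexive (lemma c d))
    where
    lemma : ∀ c d → suc c * (2 * (3 + (c + d) + c * 2) + suc (suc c)) +
      (4 + 6 * c + 5 * d + c * c * 2 + d * d + 4 * c * d) ≡ (3 + (c + d) + c * 2) * suc (3 + (c + d) + c * 2)
    lemma = solve-∀
  ≤tau0⇒innerBound c c≤ | yes n<c with m≤n⇒∃[o]m+o≡n n<c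
  ...   | e , refl = InnerBoundSquare.square⇒innerBound n e
    (≤∧≢⇒< (≤-trans (*-mono-≤ D≤s D≤s) (proj₁ (isqrt-spec (2 * k * k)))) D²≢)
    where
    D = suc (2 * e)
    D≤s : D ≤ s
    D≤s = +-cancelˡ-≤ k _ _ (begin
      k + D                  ≡⟨ lemma n e ⟩
      suc (suc n + e) * 2    ≤⟨ *-monoˡ-≤ 2 (≤-trans (s≤s c≤) (≤-reflexive (suc-pred q ⦃ >-nonZero q>0 ⦄))) ⟩
      q * 2                  ≤⟨ m/n*n≤m (k + s) 2 ⟩
      k + s                  ∎)
      where
      open ≤-Reasoning
      lemma : ∀ n e → n + (3 + n + 0) + suc (2 * e) ≡ suc (suc n + e) * 2
      lemma = solve-∀
    D²≢ : D * D ≢ 2 * k * k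
    D²≢ eq = even≢odd (k * k) (2 * (e * e + e)) (trans (sym (*-assoc 2 k k)) (trans (sym eq) (lemma e)))
      where
      lemma : ∀ e → suc (2 * e) * suc (2 * e) ≡ suc (2 * (2 * (e * e + e)))
      lemma = solve-∀

  -- For c = q the number D = 2(q + 1) - k exceeds s, because k + s < 2(q + 1); so D² > 2k² by the
  -- choice of s.
  >tau0⇒¬innerBound : ¬ InnerBound (3 + n) (suc (tau0 (3 + n)))
  >tau0⇒¬innerBound bound = main (m≤n⇒∃[o]m+o≡n n<q)
    where
    <2q+2 : k + s < suc q * 2
    <2q+2 = subst (_< suc q * 2) (sym (m≡m%n+[m/n]*n (k + s) 2)) (+-monoˡ-≤ (q * 2) (m%n<n (k + s) 2))
    n<q : suc n ≤ q
    n<q = ≰⇒> λ q≤n → <⇒≱ <2q+2 (≤-trans (*-monoˡ-≤ 2 (s≤s q≤n))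
      (≤-trans (≤-trans (n≤1+n _) (≤-reflexive (lemma n))) (m≤m+n k s)))
      where
      lemma : ∀ n → suc (suc n * 2) ≡ n + (3 + n + 0)
      lemma = solve-∀
    main : ∃ (λ e → suc n + e ≡ q) → ⊥
    main (e , eq) = <⇒≱ (proj₂ (isqrt-spec (2 * k * k))) (≤-trans (*-mono-≤ s<D s<D)
      (<⇒≤ (InnerBoundSquare.innerBound⇒square n e
        (subst (InnerBound (3 + n)) (trans (suc-pred q ⦃ >-nonZero q>0 ⦄) (sym eq)) bound))))
      where
      D = suc (2 * e)
      lemma : ∀ n e → suc (suc n + e) * 2 ≡ n + (3 + n + 0) + suc (2 * e)
      lemma = solve-∀
      s<D : s < D
      s<D = +-cancelˡ-< k s D (subst (k + s <_) (trans (cong (λ q → suc q * 2) (sym eq)) (lemma n e)) <2q+2)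

-- Inequalities are refuted by writing the left side as the right side plus 1 + d, with `d` a
-- polynomial with natural coefficients; the ring solver checks the rest.
excess : ∀ {l r} d → l ≡ suc (r + d) → ¬ l ≤ r
excess {r = r} d refl = <⇒≱ (s≤s (m≤m+n r d))

-- The sides differ by c(c - 2m - 1) = (2m + k + 2)(k + 1).
¬centerBound : ∀ m c k → c ≡ m + m + suc (suc k) → ¬ CenterBound m c
¬centerBound m c k c≡ = excess (2 * m * k + 2 * m + k * k + 3 * k + 1) (lemma m c k c≡)
  where
  identity : ∀ m k → let c = m + m + suc (suc k) ; M = m + c * 2 in
    c * (2 * M + suc c) + m * suc m ≡ suc (M * suc M + (2 * m * k + 2 * m + k * k + 3 * k + 1))
  identity = solve-∀
  lemma : ∀ m c k → c ≡ m + m + suc (suc k) → let M = m + c * 2 in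
    c * (2 * M + suc c) + m * suc m ≡ suc (M * suc M + (2 * m * k + 2 * m + k * k + 3 * k + 1))
  lemma m _ k refl = identity m k

¬outerBound : ∀ {b m c} → ¬ CenterBound m c → ¬ StarBound m c ⊎ ¬ LeafBound b m c → ¬ OuterBound b m c
¬outerBound ¬center _            (inj₁ center)     = ¬center center
¬outerBound _       (inj₁ ¬star) (inj₂ (star , _)) = ¬star star
¬outerBound _       (inj₂ ¬leaf) (inj₂ (_ , leaf)) = ¬leaf leaf

-- The number of paths is one more than the smaller of the two terms. If that term is `tau0`,
-- `InnerBound` fails; if it is 2m + i, then c = 2m + k + 2, which excludes the case without a
-- centre of sum z and leaves `StarBound` or `LeafBound` to be refuted.
notAntimagic : ∀ a b i k → i ≡ suc k → 1 ≤ a → 1 ≤ b →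
  (∀ m c → m ≡ suc (a + b) → c ≡ m + m + suc (suc k) → ¬ StarBound m c ⊎ ¬ LeafBound b m c) →
  ¬ Antimagic (DoubleStar a b ⊕ copies (suc (tau0 (a + b + 1) ⊓ tauI (a + b + 1) i)) P3)
notAntimagic a b i k i≡ 1≤a 1≤b ¬bound antimagic
  with labeling⇒bounds 1≤a 1≤b (antimagic⇒labeling a b _ antimagic)
     | ⊓-sel (tau0 (a + b + 1)) (tauI (a + b + 1) i)
... | _ , outer | inj₂ eq =
  ¬outerBound {b} {suc (a + b)} {c} (¬centerBound (suc (a + b)) c k c≡) (¬bound (suc (a + b)) c refl c≡) outer
  where
  lemma : ∀ a b k → suc (2 * (a + b + 1) + suc k) ≡ suc (a + b) + suc (a + b) + suc (suc k)
  lemma = solve-∀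
  c = suc (tau0 (a + b + 1) ⊓ tauI (a + b + 1) i)
  c≡ : c ≡ suc (a + b) + suc (a + b) + suc (suc k)
  c≡ = trans (cong suc (trans eq (cong (2 * (a + b + 1) +_) i≡))) (lemma a b k)
... | inner , _ | inj₁ eq with m≤n⇒∃[o]m+o≡n 1≤a | m≤n⇒∃[o]m+o≡n 1≤b
...   | a′ , refl | b′ , refl = >tau0⇒¬innerBound (a′ + b′)
  (subst₂ InnerBound (lemma a′ b′) (cong suc (trans eq (cong tau0 (trans (+-comm (suc a′ + suc b′) 1) (lemma a′ b′))))) inner)
  where
  lemma : ∀ a′ b′ → suc (suc a′ + suc b′) ≡ 3 + (a′ + b′)
  lemma = solve-∀

module _ (a b : ℕ) (1≤a : 1 ≤ a) (1≤b : 1 ≤ b) where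

  notAntimagic-1 : a ≡ 1 → ¬ Antimagic (DoubleStar a b ⊕ copies (suc (tau0 (a + b + 1) ⊓ tauI (a + b + 1) 1)) P3)
  notAntimagic-1 a≡1 = notAntimagic a b 1 0 refl 1≤a 1≤b
    (λ m c m≡ c≡ → inj₂ (excess (5 + 2 * b) (lemma b m c (trans m≡ (cong (λ a → suc (a + b)) a≡1)) c≡)))
    where
    identity : ∀ b → let m = suc (1 + b) ; c = m + m + 2 ; M = m + c * 2 in
      c * (2 * M + suc c) + suc (suc b) * suc (suc (suc b)) ≡ suc (M * suc M + (5 + 2 * b))
    identity = solve-∀
    lemma : ∀ b m c → m ≡ suc (1 + b) → c ≡ m + m + 2 → let M = m + c * 2 in
      c * (2 * M + suc c) + suc (suc b) * suc (suc (suc b)) ≡ suc (M * suc M + (5 + 2 * b))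
    lemma b _ _ refl refl = identity b

  -- At c = 2m + a the sides of `LeafBound` differ by 2(a - 1)² = 2(k + 1)², independently of b.
  notAntimagic-2+ : ∀ i k → i ≡ suc k → a ≡ 2 + k →
    ¬ Antimagic (DoubleStar a b ⊕ copies (suc (tau0 (a + b + 1) ⊓ tauI (a + b + 1) i)) P3)
  notAntimagic-2+ i k i≡ a≡ = notAntimagic a b i k i≡ 1≤a 1≤b
    (λ m c m≡ c≡ → inj₂ (excess (1 + 4 * k + 2 * k * k) (lemma k b m c (trans m≡ (cong (λ a → suc (a + b)) a≡)) c≡)))
    where
    identity : ∀ k b → let m = suc (2 + k + b) ; c = m + m + (2 + k) ; M = m + c * 2 in
      c * (2 * M + suc c) + suc (suc b) * suc (suc (suc b)) ≡ suc (M * suc M + (1 + 4 * k + 2 * k * k))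
    identity = solve-∀
    lemma : ∀ k b m c → m ≡ suc (2 + k + b) → c ≡ m + m + (2 + k) → let M = m + c * 2 in
      c * (2 * M + suc c) + suc (suc b) * suc (suc (suc b)) ≡ suc (M * suc M + (1 + 4 * k + 2 * k * k))
    lemma k b _ _ refl refl = identity k b

  notAntimagic-7 : a ≡ 7 → b ≤ 21 →
    ¬ Antimagic (DoubleStar a b ⊕ copies (suc (tau0 (a + b + 1) ⊓ tauI (a + b + 1) 5)) P3)
  notAntimagic-7 a≡7 b≤21 = notAntimagic a b 5 4 refl 1≤a 1≤b
    (λ m c m≡ c≡ → inj₂ λ bound →
      -- Here `LeafBound` amounts to 44 ≤ 2b.
      <⇒≱ (+-monoʳ-< ((m + c * 2) * suc (m + c * 2)) {2 * b} {44} (s≤s (m≤n⇒m≤1+n (*-monoʳ-≤ 2 b≤21))))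
          (≤-trans (≤-reflexive (sym (lemma b m c (trans m≡ (cong (λ a → suc (a + b)) a≡7)) c≡))) (+-monoˡ-≤ (2 * b) bound)))
    where
    identity : ∀ b → let m = suc (7 + b) ; c = m + m + 6 ; M = m + c * 2 in
      c * (2 * M + suc c) + suc (suc b) * suc (suc (suc b)) + 2 * b ≡ M * suc M + 44
    identity = solve-∀
    lemma : ∀ b m c → m ≡ suc (7 + b) → c ≡ m + m + 6 → let M = m + c * 2 in
      c * (2 * M + suc c) + suc (suc b) * suc (suc (suc b)) + 2 * b ≡ M * suc M + 44
    lemma b _ _ refl refl = identity b

  -- At c = 2m + 7 the sides of `StarBound` differ by c - 1 = 2m + 6.
  notAntimagic-any : ¬ Antimagic (DoubleStar a b ⊕ copies (suc (tau0 (a + b + 1) ⊓ tauI (a + b + 1) 6)) P3)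
  notAntimagic-any = notAntimagic a b 6 5 refl 1≤a 1≤b
    (λ m c _ c≡ → inj₁ (excess (5 + 2 * m) (lemma m c (trans c≡ (+-suc (m + m) 6)))))
    where
    identity : ∀ m → let c = suc (m + m + 6) ; M = m + c * 2 in
      (m + m + 6) * (2 * M + c) + suc (suc m) * suc (suc (suc m)) ≡ suc (M * suc M + (5 + 2 * m))
    identity = solve-∀
    lemma : ∀ m c → c ≡ suc (m + m + 6) → let M = m + c * 2 in
      pred c * (2 * M + c) + suc (suc m) * suc (suc (suc m)) ≡ suc (M * suc M + (5 + 2 * m))
    lemma m _ refl = identity m

-- Ladder layouts

-- The two labels increase together: opposite orders would make all sums equal, while progressions
-- of difference 2 can interleave with those of a second ladder and fill consecutive integers.
ladder : ℕ → ℕ → ℕ → List (ℕ × ℕ)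
ladder l h zero    = []
ladder l h (suc k) = (suc l , suc h) ∷ ladder (suc l) (suc h) k

length-ladder : ∀ l h k → length (ladder l h k) ≡ k
length-ladder l h zero    = refl
length-ladder l h (suc k) = cong suc (length-ladder (suc l) (suc h) k)

flatten-ladder : ∀ l h k → flatten (ladder l h k) ↭ interval l k ++ interval h k
flatten-ladder l h zero    = ↭-refl
flatten-ladder l h (suc k) = ↭-prep (suc l) (↭-trans (↭-prep (suc h) (flatten-ladder (suc l) (suc h) k))
  (↭-sym (shift (suc h) (interval (suc l) k) (interval (suc h) k))))

flatten-++ : ∀ ps qs → flatten (ps ++ qs) ≡ flatten ps ++ flatten qs
flatten-++ []             qs = refl
flatten-++ ((p , q) ∷ ps) qs = cong (λ xs → p ∷ q ∷ xs) (flatten-++ ps qs)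

∈-centers-ladder : ∀ {s} l h k → s ∈ centers (ladder l h k) → ∃ λ i → i < k × s ≡ suc (suc (l + h + 2 * i))
∈-centers-ladder l h (suc k) (here refl) = 0 , s≤s z≤n , lemma l h
  where
  lemma : ∀ l h → suc l + suc h ≡ suc (suc (l + h + 0))
  lemma = solve-∀
∈-centers-ladder l h (suc k) (there s∈) with ∈-centers-ladder (suc l) (suc h) k s∈
... | i , i<k , refl = suc i , s≤s i<k , lemma l h i
  where
  lemma : ∀ l h i → suc (suc (suc l + suc h + 2 * i)) ≡ suc (suc (l + h + 2 * suc i))
  lemma = solve-∀

centers-ladder-≥ : ∀ l h k {s} → s ∈ centers (ladder l h k) → suc (suc (l + h)) ≤ s
centers-ladder-≥ l h k s∈ with ∈-centers-ladder l h k s∈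
... | i , _ , refl = s≤s (s≤s (m≤m+n (l + h) (2 * i)))

centers-ladder-bounded : ∀ l h k {R} → l + h + 2 * k ≤ R → ∀ {s} → s ∈ centers (ladder l h k) → s ≤ R
centers-ladder-bounded l h k b s∈ with ∈-centers-ladder l h k s∈
... | i , i<k , refl = ≤-trans (≤-reflexive (lemma l h i)) (≤-trans (+-monoʳ-≤ (l + h) (*-monoʳ-≤ 2 i<k)) b)
  where
  lemma : ∀ l h i → suc (suc (l + h + 2 * i)) ≡ l + h + 2 * suc i
  lemma = solve-∀

centers-ladder-unique : ∀ l h k → Unique (centers (ladder l h k))
centers-ladder-unique l h zero    = []
centers-ladder-unique l h (suc k) = All.tabulate head∉ ∷ centers-ladder-unique (suc l) (suc h) k
  where
  head∉ : ∀ {s} → s ∈ centers (ladder (suc l) (suc h) k) → suc l + suc h ≢ s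
  head∉ s∈ with ∈-centers-ladder (suc l) (suc h) k s∈
  ... | i , _ , refl = <⇒≢ (s≤s (≤-trans (m≤m+n _ (2 * i)) (n≤1+n _)))

-- A layout of the labels 1, …, M: the free labels 1, …, ℓ, followed by the blocks L₁ (k₁ labels),
-- L₂ (k₂ labels), H₁ (k₂ labels), H₂ (k₁ labels), where dᵢ further free labels follow the i-th
-- block.  Pairing L₁ with H₂ and L₂ with H₁ in increasing order gives the paths.
record Layout : Set where
  constructor layout
  field
    ℓ d₁ d₂ d₃ d₄ k₁ k₂ : ℕ

  g₁ = ℓ + k₁
  L₂ = g₁ + d₁
  g₂ = L₂ + k₂
  H₁ = g₂ + d₂
  g₃ = H₁ + k₂
  H₂ = g₃ + d₃
  g₄ = H₂ + k₁
  M  = g₄ + d₄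

  holes free : List ℕ
  holes = interval g₁ d₁ ++ interval g₂ d₂ ++ interval g₃ d₃ ++ interval g₄ d₄
  free  = interval 0 ℓ ++ holes

  rungs : List (ℕ × ℕ)
  rungs = ladder ℓ H₂ k₁ ++ ladder L₂ H₁ k₂

  length-rungs : length rungs ≡ k₁ + k₂
  length-rungs = trans (length-++ (ladder ℓ H₂ k₁)) (cong₂ _+_ (length-ladder ℓ H₂ k₁) (length-ladder L₂ H₁ k₂))

  -- The nine blocks are put into their order on the number line and then merged with their
  -- neighbours from the left.
  free++rungs : free ++ flatten rungs ↭ interval 0 M
  free++rungs = begin
    free ++ flatten rungs
      ≡⟨ cong (free ++_) (flatten-++ (ladder ℓ H₂ k₁) (ladder L₂ H₁ k₂)) ⟩
    free ++ flatten (ladder ℓ H₂ k₁) ++ flatten (ladder L₂ H₁ k₂)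
      ↭⟨ ++⁺ˡ free (++⁺ (flatten-ladder ℓ H₂ k₁) (flatten-ladder L₂ H₁ k₂)) ⟩
    free ++ (interval ℓ k₁ ++ interval H₂ k₁) ++ interval L₂ k₂ ++ interval H₁ k₂
      ↭⟨ solve 9 (λ i₀ h₁ h₂ h₃ h₄ l₁ h₂′ l₂ h₁′ →
           (i₀ ∙ h₁ ∙ h₂ ∙ h₃ ∙ h₄) ∙ (l₁ ∙ h₂′) ∙ l₂ ∙ h₁′ ⊜
           (((((((i₀ ∙ l₁) ∙ h₁) ∙ l₂) ∙ h₂) ∙ h₁′) ∙ h₃) ∙ h₂′) ∙ h₄) ↭-refl
           (interval 0 ℓ) (interval g₁ d₁) (interval g₂ d₂) (interval g₃ d₃) (interval g₄ d₄)
           (interval ℓ k₁) (interval H₂ k₁) (interval L₂ k₂) (interval H₁ k₂) ⟩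
    (((((((interval 0 ℓ ++ interval ℓ k₁) ++ interval g₁ d₁) ++ interval L₂ k₂) ++ interval g₂ d₂)
      ++ interval H₁ k₂) ++ interval g₃ d₃) ++ interval H₂ k₁) ++ interval g₄ d₄
      ≡⟨ cong (λ xs → ((((((xs ++ interval g₁ d₁) ++ interval L₂ k₂) ++ interval g₂ d₂)
           ++ interval H₁ k₂) ++ interval g₃ d₃) ++ interval H₂ k₁) ++ interval g₄ d₄) (interval-++ 0 ℓ k₁) ⟩
    ((((((interval 0 g₁ ++ interval g₁ d₁) ++ interval L₂ k₂) ++ interval g₂ d₂)
      ++ interval H₁ k₂) ++ interval g₃ d₃) ++ interval H₂ k₁) ++ interval g₄ d₄
      ≡⟨ cong (λ xs → (((((xs ++ interval L₂ k₂) ++ interval g₂ d₂)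
           ++ interval H₁ k₂) ++ interval g₃ d₃) ++ interval H₂ k₁) ++ interval g₄ d₄) (interval-++ 0 g₁ d₁) ⟩
    (((((interval 0 L₂ ++ interval L₂ k₂) ++ interval g₂ d₂)
      ++ interval H₁ k₂) ++ interval g₃ d₃) ++ interval H₂ k₁) ++ interval g₄ d₄
      ≡⟨ cong (λ xs → ((((xs ++ interval g₂ d₂) ++ interval H₁ k₂) ++ interval g₃ d₃)
           ++ interval H₂ k₁) ++ interval g₄ d₄) (interval-++ 0 L₂ k₂) ⟩
    ((((interval 0 g₂ ++ interval g₂ d₂) ++ interval H₁ k₂) ++ interval g₃ d₃) ++ interval H₂ k₁) ++ interval g₄ d₄
      ≡⟨ cong (λ xs → (((xs ++ interval H₁ k₂) ++ interval g₃ d₃) ++ interval H₂ k₁) ++ interval g₄ d₄)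
           (interval-++ 0 g₂ d₂) ⟩
    (((interval 0 H₁ ++ interval H₁ k₂) ++ interval g₃ d₃) ++ interval H₂ k₁) ++ interval g₄ d₄
      ≡⟨ cong (λ xs → ((xs ++ interval g₃ d₃) ++ interval H₂ k₁) ++ interval g₄ d₄) (interval-++ 0 H₁ k₂) ⟩
    ((interval 0 g₃ ++ interval g₃ d₃) ++ interval H₂ k₁) ++ interval g₄ d₄
      ≡⟨ cong (λ xs → (xs ++ interval H₂ k₁) ++ interval g₄ d₄) (interval-++ 0 g₃ d₃) ⟩
    (interval 0 H₂ ++ interval H₂ k₁) ++ interval g₄ d₄
      ≡⟨ cong (_++ interval g₄ d₄) (interval-++ 0 H₂ k₁) ⟩
    interval 0 g₄ ++ interval g₄ d₄
      ≡⟨ interval-++ 0 g₄ d₄ ⟩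
    interval 0 M ∎
    where
    open PermutationReasoning
    open ListSolver using (solve; _⊜_) renaming (_⊕_ to _∙_)

  -- The rung sums of each ladder form an arithmetic progression with difference 2;
  -- odd says that the two progressions have different parities.
  record Valid : Set where
    field
      half   : ℕ
      odd : k₁ + d₁ + (k₂ + d₃) ≡ suc (2 * half)
      large₁ : M < suc (suc (ℓ + H₂))
      large₂ : M < suc (suc (L₂ + H₁))

  rungs-≥ : ∀ {r} → r ≤ suc (suc (ℓ + H₂)) → r ≤ suc (suc (L₂ + H₁)) → ∀ {s} → s ∈ centers rungs → r ≤ s
  rungs-≥ r≤₁ r≤₂ s∈ with ∈-++⁻ (centers (ladder ℓ H₂ k₁))
                            (subst (_ ∈_) (map-++ center (ladder ℓ H₂ k₁) (ladder L₂ H₁ k₂)) s∈)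
  ... | inj₁ s∈₁ = ≤-trans r≤₁ (centers-ladder-≥ ℓ H₂ k₁ s∈₁)
  ... | inj₂ s∈₂ = ≤-trans r≤₂ (centers-ladder-≥ L₂ H₁ k₂ s∈₂)

  rungs-≤ : ∀ {r} → ℓ + H₂ + 2 * k₁ ≤ r → L₂ + H₁ + 2 * k₂ ≤ r → ∀ {s} → s ∈ centers rungs → s ≤ r
  rungs-≤ ≤r₁ ≤r₂ s∈ with ∈-++⁻ (centers (ladder ℓ H₂ k₁))
                            (subst (_ ∈_) (map-++ center (ladder ℓ H₂ k₁) (ladder L₂ H₁ k₂)) s∈)
  ... | inj₁ s∈₁ = centers-ladder-bounded ℓ H₂ k₁ ≤r₁ s∈₁
  ... | inj₂ s∈₂ = centers-ladder-bounded L₂ H₁ k₂ ≤r₂ s∈₂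

  module _ (valid : Valid) where
    open Valid valid

    rungs-large : All (M <_) (centers rungs)
    rungs-large = All.tabulate (rungs-≥ large₁ large₂)

    rungs-unique : Unique (centers rungs)
    rungs-unique = subst Unique (sym (map-++ center (ladder ℓ H₂ k₁) (ladder L₂ H₁ k₂)))
      (Unique.++⁺ (centers-ladder-unique ℓ H₂ k₁) (centers-ladder-unique L₂ H₁ k₂) disjoint)
      where
      disjoint : ∀ {s} → s ∈ centers (ladder ℓ H₂ k₁) × s ∈ centers (ladder L₂ H₁ k₂) → ⊥
      disjoint (s∈₁ , s∈₂) with ∈-centers-ladder ℓ H₂ k₁ s∈₁ | ∈-centers-ladder L₂ H₁ k₂ s∈₂
      -- The first sums of the ladders differ by k₂ + d₃ - (k₁ + d₁), which is odd together with the
      -- sum of the four numbers; adding k₁ + d₁ to both sides avoids the subtraction.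
      ... | i , _ , refl | j , _ , eq = even≢odd (k₁ + d₁ + j) (half + i) (sym (+-cancelˡ-≡ (ℓ + H₁) _ _ (begin
        ℓ + H₁ + suc (2 * (half + i))                ≡⟨ lemma₁ (ℓ + H₁) half i ⟩
        ℓ + H₁ + suc (2 * half) + 2 * i              ≡⟨ cong (λ t → ℓ + H₁ + t + 2 * i) odd ⟨
        ℓ + H₁ + (k₁ + d₁ + (k₂ + d₃)) + 2 * i       ≡⟨ lemma₂ ℓ H₁ k₁ d₁ k₂ d₃ i ⟩
        ℓ + (H₁ + k₂ + d₃) + 2 * i + (k₁ + d₁)       ≡⟨ cong (_+ (k₁ + d₁)) (suc-injective (suc-injective eq)) ⟩
        ℓ + k₁ + d₁ + H₁ + 2 * j + (k₁ + d₁)         ≡⟨ lemma₃ ℓ H₁ k₁ d₁ j ⟩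
        ℓ + H₁ + 2 * (k₁ + d₁ + j)                   ∎)))
        where
        open ≡-Reasoning
        lemma₁ : ∀ x h i → x + suc (2 * (h + i)) ≡ x + suc (2 * h) + 2 * i
        lemma₁ = solve-∀
        lemma₂ : ∀ ℓ H k d k′ d′ i → ℓ + H + (k + d + (k′ + d′)) + 2 * i ≡ ℓ + (H + k′ + d′) + 2 * i + (k + d)
        lemma₂ = solve-∀
        lemma₃ : ∀ ℓ H k d j → ℓ + k + d + H + 2 * j + (k + d) ≡ ℓ + H + 2 * (k + d + j)
        lemma₃ = solve-∀

-- The only path centre that is at most M is that of (p , q), whose sum is the internal label.
labeling : ∀ {M} p q A B ps → let z = p + q in
  (z ∷ A ++ B) ++ p ∷ q ∷ flatten ps ↭ interval 0 M →
  Unique (z + sum A ∷ z + sum B ∷ centers ps) → All (M <_) (z + sum A ∷ z + sum B ∷ centers ps) →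
  Labeling (length A) (length B) (suc (length ps))
labeling {M} p q A B ps labels distinct large = record
  { z         = p + q
  ; A         = A
  ; B         = B
  ; paths     = (p , q) ∷ ps
  ; length-A  = refl
  ; length-B  = refl
  ; length-ps = refl
  ; labels    = subst (λ n → _ ↭ interval 0 n) M≡ labels
  ; distinct  = Unique-resp-↭ (↭-sym sums) (Unique.++⁺ (Unique-resp-↭ (↭-sym labels) (interval-unique 0 M)) distinct
      λ (s∈₁ , s∈₂) → <⇒≱ (All.lookup large s∈₂) (proj₂ (∈-interval⁻ 0 M (∈-resp-↭ labels s∈₁))))
  }
  where
  z = p + q
  length-flatten : ∀ ps → length (flatten ps) ≡ length ps * 2
  length-flatten []       = refl
  length-flatten (_ ∷ ps) = cong (2 +_) (length-flatten ps)
  M≡ : M ≡ suc (length A + length B) + suc (length ps) * 2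
  M≡ = trans (sym (length-interval 0 M)) (trans (sym (↭-length labels)) (trans (length-++ (z ∷ A ++ B))
    (cong₂ _+_ (cong suc (length-++ A)) (cong (2 +_) (length-flatten ps)))))
  sums : starSums z A B ++ pathSums ((p , q) ∷ ps) ↭
    ((z ∷ A ++ B) ++ p ∷ q ∷ flatten ps) ++ z + sum A ∷ z + sum B ∷ centers ps
  sums = begin
    starSums z A B ++ pathSums ((p , q) ∷ ps)
      ↭⟨ sums-↭ z A B ((p , q) ∷ ps) ⟩
    leaves A B ((p , q) ∷ ps) ++ z + sum A ∷ z + sum B ∷ z ∷ centers ps
      ↭⟨ ++⁺ˡ (leaves A B ((p , q) ∷ ps)) (shift z (z + sum A ∷ z + sum B ∷ []) (centers ps)) ⟩
    leaves A B ((p , q) ∷ ps) ++ z ∷ z + sum A ∷ z + sum B ∷ centers ps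
      ↭⟨ shift z (leaves A B ((p , q) ∷ ps)) _ ⟩
    z ∷ leaves A B ((p , q) ∷ ps) ++ z + sum A ∷ z + sum B ∷ centers ps
      ≡⟨ cong (λ xs → z ∷ xs ++ z + sum A ∷ z + sum B ∷ centers ps) (++-assoc A B _) ⟨
    ((z ∷ A ++ B) ++ p ∷ q ∷ flatten ps) ++ z + sum A ∷ z + sum B ∷ centers ps ∎
    where open PermutationReasoning

layout⇒labeling : ∀ (lay : Layout) → let open Layout lay in Valid → ∀ p q A B → let z = p + q in
  free ↭ z ∷ p ∷ q ∷ A ++ B →
  M < z + sum A → M < z + sum B → z + sum A ≢ z + sum B →
  z + sum A ∉ centers rungs → z + sum B ∉ centers rungs →
  Labeling (length A) (length B) (suc (k₁ + k₂))
layout⇒labeling lay valid p q A B free↭ M<x M<y x≢y x∉ y∉ =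
  subst (λ c → Labeling (length A) (length B) (suc c)) length-rungs
    (labeling p q A B rungs labels
      ((x≢y ∷ All.tabulate (λ s∈ eq → x∉ (subst (_∈ _) (sym eq) s∈))) ∷
       All.tabulate (λ s∈ eq → y∉ (subst (_∈ _) (sym eq) s∈)) ∷ rungs-unique valid)
      (M<x ∷ M<y ∷ rungs-large valid))
  where
  open Layout lay
  z = p + q
  labels : (z ∷ A ++ B) ++ p ∷ q ∷ flatten rungs ↭ interval 0 M
  labels = ↭-trans (↭-prep z (↭-trans (shifts (A ++ B) (p ∷ q ∷ [])) ↭-refl))
    (↭-trans (++⁺ʳ (flatten rungs) (↭-sym free↭)) free++rungs)

-- Small stars by search

remove : ℕ → List ℕ → Maybe (List ℕ)
remove x []       = nothing
remove x (y ∷ ys) = if x ≡ᵇ y then just ys else Maybe.map (y ∷_) (remove x ys)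

isPermutation : List ℕ → List ℕ → Bool
isPermutation []       []      = true
isPermutation []       (_ ∷ _) = false
isPermutation (x ∷ xs) ys with remove x ys
... | nothing = false
... | just zs = isPermutation xs zs

remove-↭ : ∀ x ys {zs} → remove x ys ≡ just zs → ys ↭ x ∷ zs
remove-↭ x (y ∷ ys) eq with x ≡ᵇ y in x≡ᵇy
remove-↭ x (y ∷ ys) refl | true = ↭-reflexive (cong (_∷ ys) (sym (≡ᵇ⇒≡ x y (subst T (sym x≡ᵇy) _))))
... | false with remove x ys in eq′
remove-↭ x (y ∷ ys) refl | false | just zs = ↭-trans (↭-prep y (remove-↭ x ys eq′)) (↭-swap y x ↭-refl)

isPermutation-↭ : ∀ xs ys → T (isPermutation xs ys) → xs ↭ ys
isPermutation-↭ []       []       _ = ↭-refl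
isPermutation-↭ (x ∷ xs) ys       t with remove x ys in eq
... | just zs = ↭-sym (↭-trans (remove-↭ x ys eq) (↭-prep x (↭-sym (isPermutation-↭ xs zs t))))

module _ (lay : Layout) where
  open Layout lay

  Valid? : Dec ((k₁ + d₁ + (k₂ + d₃)) % 2 ≡ 1 × M < suc (suc (ℓ + H₂)) × M < suc (suc (L₂ + H₁)))
  Valid? = _ ≟ _ ×-dec _ <? _ ×-dec _ <? _

  Valid?-sound : T ⌊ Valid? ⌋ → Valid
  Valid?-sound t with toWitness t
  ... | odd , large₁ , large₂ = record
    { half   = (k₁ + d₁ + (k₂ + d₃)) / 2
    ; odd    = trans (m≡m%n+[m/n]*n (k₁ + d₁ + (k₂ + d₃)) 2)
                     (cong₂ _+_ odd (*-comm ((k₁ + d₁ + (k₂ + d₃)) / 2) 2))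
    ; large₁ = large₁
    ; large₂ = large₂
    }

_∈ᵇ_ : ℕ → List ℕ → Bool
x ∈ᵇ xs = any (x ≡ᵇ_) xs

T-not : ∀ {b} → T (not b) → ¬ T b
T-not {false} _ ()

∉ᵇ⇒∉ : ∀ {x xs} → T (not (x ∈ᵇ xs)) → x ∉ xs
∉ᵇ⇒∉ {x} t x∈ = T-not t (any⁺ (x ≡ᵇ_) (Any.map (≡⇒≡ᵇ x _) x∈))

T-and : ∀ bs → T (and bs) → All T bs
T-and []       _ = []
T-and (b ∷ bs) t with Equivalence.to (T-∧ {x = b}) t
... | tb , tbs = tb ∷ T-and bs tbs

-- The internal label is suc q, realised as the centre sum of the path with labels 1 and q;
-- x and y are the vertex sums of the two centres of the double star.
splitTests : ℕ → ℕ → ℕ → List ℕ → List ℕ → ℕ → List ℕ → List ℕ → ℕ → ℕ → List Bool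
splitTests a b M free sums q A B x y =
  (M <ᵇ x) ∷ (M <ᵇ y) ∷ not (x ≡ᵇ y) ∷ not (x ∈ᵇ sums) ∷ not (y ∈ᵇ sums) ∷
  (length A ≡ᵇ a) ∷ (length B ≡ᵇ b) ∷ isPermutation (suc q ∷ 1 ∷ q ∷ A ++ B) free ∷ []

goodSplit : ℕ → ℕ → ℕ → List ℕ → List ℕ → ℕ → List ℕ → List ℕ → Bool
goodSplit a b M free sums q A B = and (splitTests a b M free sums q A B (suc q + sum A) (suc q + sum B))

-- An entry q comes from a free label q + 1, the internal one; q itself must be free and differ from
-- 1, because it shares a path with the label 1.
internalLabels : List ℕ → List ℕ
internalLabels free = filterᵇ (λ q → (1 <ᵇ q) ∧ (q ∈ᵇ free)) (map pred free)

select : List ℕ → List (ℕ × List ℕ)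
select []       = []
select (x ∷ xs) = (x , xs) ∷ map (λ (y , ys) → y , x ∷ ys) (select xs)

-- A consists of one entry of a window of b + 1 consecutive entries of W and of everything outside it.
splits : ℕ → ℕ → List ℕ → List (List ℕ × List ℕ)
splits a b W = concatMap
  (λ k → map (λ (x , mid) → x ∷ take k W ++ drop (k + suc b) W , mid) (select (take (suc b) (drop k W))))
  (downFrom a)

without : ℕ → List ℕ → List ℕ
without q = filterᵇ (λ w → not ((w ≡ᵇ 1) ∨ (w ≡ᵇ q) ∨ (w ≡ᵇ suc q)))

-- The hole sizes were found by experiment; N counts the paths other than (1 , q).
layouts : ℕ → ℕ → List Layout
layouts m N = if N % 2 ≡ᵇ 0
  then shape 1 2 0 0 0 0 ∷ shape 0 0 1 0 0 0 ∷ shape 1 0 0 0 0 0 ∷ shape 0 0 1 1 0 0 ∷ shape 0 1 1 1 0 0 ∷ []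
  else shape 1 1 1 0 0 1 ∷ shape 1 0 1 0 0 1 ∷ shape 0 0 0 0 1 0 ∷ shape 0 0 2 0 1 0 ∷ shape 0 0 0 2 0 1 ∷ []
  where
  shape : ℕ → ℕ → ℕ → ℕ → ℕ → ℕ → Layout
  shape d₁ d₂ d₃ d₄ e₁ e₂ = layout (2 + m ∸ (d₁ + d₂ + d₃ + d₄)) d₁ d₂ d₃ d₄ (N / 2 + e₁) (N / 2 + e₂)

-- The list `free` is decreasing where this is called, so the search begins with large internal
-- labels and with sets A that take the largest labels.
searchSplit : ℕ → ℕ → ℕ → List ℕ → List ℕ → Bool
searchSplit a b M free sums = any
  (λ q → any (λ (A , B) → goodSplit a b M free sums q A B) (splits a b (without q free)))
  (internalLabels free)

search : ℕ → ℕ → ℕ → Bool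
search a b N = any
  (λ lay → let open Layout lay in
     ⌊ Valid? lay ⌋ ∧ (k₁ + k₂ ≡ᵇ N) ∧ searchSplit a b M (reverse free) (centers rungs))
  (layouts (suc (a + b)) N)

goodSplit-sound : ∀ lay {a b N} q A B → let open Layout lay in T ⌊ Valid? lay ⌋ → T (k₁ + k₂ ≡ᵇ N) →
  T (goodSplit a b M (reverse free) (centers rungs) q A B) → Labeling a b (suc N)
goodSplit-sound lay {a} {b} {N} q A B isValid isN good
  with T-and (splitTests a b (Layout.M lay) (reverse (Layout.free lay)) (centers (Layout.rungs lay)) q A B
               (suc q + sum A) (suc q + sum B)) good
... | M<x ∷ M<y ∷ x≢y ∷ x∉ ∷ y∉ ∷ isA ∷ isB ∷ perm ∷ []
  with refl ← ≡ᵇ⇒≡ (length A) a isA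
     | refl ← ≡ᵇ⇒≡ (length B) b isB
     | refl ← ≡ᵇ⇒≡ (Layout.k₁ lay + Layout.k₂ lay) N isN
  = layout⇒labeling lay (Valid?-sound lay isValid) 1 q A B
      (↭-trans (↭-sym (↭-reverse (Layout.free lay))) (↭-sym (isPermutation-↭ _ _ perm)))
      (<ᵇ⇒< _ _ M<x) (<ᵇ⇒< _ _ M<y) (λ x≡y → T-not x≢y (≡⇒≡ᵇ _ _ x≡y)) (∉ᵇ⇒∉ x∉) (∉ᵇ⇒∉ y∉)

search-sound : ∀ a b N → T (search a b N) → Labeling a b (suc N)
search-sound a b N found with satisfied (any⁻ _ (layouts (suc (a + b)) N) found)
... | lay , ok with Equivalence.to (T-∧ {x = ⌊ Valid? lay ⌋}) ok
...   | isValid , ok′ with Equivalence.to (T-∧ {x = Layout.k₁ lay + Layout.k₂ lay ≡ᵇ N}) ok′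
...     | isN , ok″ with satisfied (any⁻ _ (internalLabels (reverse (Layout.free lay))) ok″)
...       | q , ok‴ with satisfied (any⁻ _ (splits a b (without q (reverse (Layout.free lay)))) ok‴)
...         | (A , B) , good = goodSplit-sound lay q A B isValid isN good

allBelow : ℕ → (ℕ → Bool) → Bool
allBelow zero    p = true
allBelow (suc n) p = p n ∧ allBelow n p

allBelow-sound : ∀ n (p : ℕ → Bool) → allBelow n p ≡ true → ∀ {k} → k < n → p k ≡ true
allBelow-sound (suc n) p eq {k} k<1+n with p n in pn
... | true with m<1+n⇒m<n∨m≡n k<1+n
...   | inj₁ k<n  = allBelow-sound n p eq k<n
...   | inj₂ refl = pn

-- The second argument of ⊓ in the theorem is 2 m + surplus a b.
surplus : ℕ → ℕ → ℕ
surplus a b = if a ≤ᵇ 1 then 1 else if a ≤ᵇ 6 then pred a else if (a ≡ᵇ 7) ∧ (b ≤ᵇ 21) then 5 else 6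

innerBoundᵇ : ℕ → ℕ → Bool
innerBoundᵇ m c = let M = m + c * 2 in suc c * (2 * M + suc (suc c)) ≤ᵇ M * suc M

-- Here `c` counts the paths besides (1 , q), so `InnerBound` is tested at `suc c`; where it fails,
-- the number of paths exceeds τ₀ and no labeling is called for.
checkPaths : ℕ → ℕ → ℕ → Bool
checkPaths a b c = not (innerBoundᵇ (suc (a + b)) (suc c)) ∨ search a b c

checkStar : ℕ → ℕ → Bool
checkStar a d = let b = suc a + d in allBelow (2 * suc (suc a + b) + surplus (suc a) b) (checkPaths (suc a) b)

checkStars : ℕ → Bool
-- The star has a + 1 and a + 1 + d leaves at its centres, so at most 37 leaves means d < 36 - 2a.
checkStars a = allBelow (36 ∸ (a + a)) (checkStar a)

opaque
  -- The searches for all stars with at most 37 leaves run here, in one evaluation by the type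
  -- checker; `opaque` keeps later uses from unfolding it.
  smallStars : allBelow 18 checkStars ≡ true
  smallStars = refl

smallStar : ∀ {a b c} → 1 ≤ a → a ≤ b → a + b ≤ 37 → c < 2 * suc (a + b) + surplus a b →
  InnerBound (suc (a + b)) (suc c) → Labeling a b (suc c)
smallStar {suc a} {b} {c} _ a<b a+b≤37 c< inner with m≤n⇒∃[o]m+o≡n a<b
... | d , refl = [ (λ t → contradiction (≤⇒≤ᵇ inner) (T-not t)) , search-sound (suc a) (suc a + d) c ]′
  (Equivalence.to (T-∨ {x = not (innerBoundᵇ (suc (suc a + (suc a + d))) (suc c))}) (subst T (sym paths) _))
  where
  a+d< : a + a + d < 36
  a+d< = ≤-pred (≤-pred (≤-trans (≤-reflexive (lemma a d)) (s≤s a+b≤37)))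
    where
    lemma : ∀ a d → suc (suc (suc (a + a + d))) ≡ suc (suc a + (suc a + d))
    lemma = solve-∀
  a<18 : a < 18
  a<18 = *-cancelˡ-< 2 a 18 (≤-trans (s≤s (≤-trans (≤-reflexive (cong (a +_) (+-identityʳ a))) (m≤m+n (a + a) d))) a+d<)
  d< : d < 36 ∸ (a + a)
  d< = m+n≤o⇒m≤o∸n (suc d) (≤-trans (≤-reflexive (cong suc (+-comm d (a + a)))) a+d<)
  stars : checkStars a ≡ true
  stars = allBelow-sound 18 checkStars smallStars a<18
  star : checkStar a d ≡ true
  star = allBelow-sound (36 ∸ (a + a)) (checkStar a) stars d<
  paths : checkPaths (suc a) (suc a + d) c ≡ true
  paths = allBelow-sound (2 * suc (suc a + (suc a + d)) + surplus (suc a) (suc a + d))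
    (checkPaths (suc a) (suc a + d)) star c<

-- Large stars

-- `hs` and `hs′` are the holes given to x and y. Of the labels 2, ..., ℓ - 2 the k lowest bring A
-- to its size at little cost to y, the i highest make x large, and the b in between go to y.
module Family (lay : Layout) (valid : Layout.Valid lay) (k b i : ℕ) (hs hs′ : List ℕ)
  (ℓ≡ : Layout.ℓ lay ≡ 3 + (k + b + i)) (holes↭ : Layout.holes lay ↭ hs ++ hs′) where

  open Layout lay

  -- The internal label is ℓ, realised as the centre sum 1 + (ℓ - 1).
  A B : List ℕ
  A = hs ++ interval 1 k ++ interval (1 + k + b) i
  B = interval (1 + k) b ++ hs′

  x y : ℕ
  x = ℓ + sum A
  y = ℓ + sum B

  private
    r = k + b + i

    low-↭ : interval 0 (3 + r) ↭ 3 + r ∷ 1 ∷ 2 + r ∷ interval 1 r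
    low-↭ = begin
      1 ∷ interval 1 (2 + r)                        ≡⟨ cong (λ n → 1 ∷ interval 1 n) (+-comm 2 r) ⟩
      1 ∷ interval 1 (r + 2)                        ≡⟨ cong (1 ∷_) (interval-++ 1 r 2) ⟨
      1 ∷ interval 1 r ++ 2 + r ∷ 3 + r ∷ []        ↭⟨ ↭-prep 1 (++-comm (interval 1 r) (2 + r ∷ 3 + r ∷ [])) ⟩
      1 ∷ 2 + r ∷ 3 + r ∷ interval 1 r              ↭⟨ shift (3 + r) (1 ∷ 2 + r ∷ []) (interval 1 r) ⟩
      3 + r ∷ 1 ∷ 2 + r ∷ interval 1 r              ∎
      where open PermutationReasoning

    split : interval 1 r ++ holes ↭ A ++ B
    split = begin
      interval 1 (k + b + i) ++ holes
        ≡⟨ cong (_++ holes) (trans (sym (interval-++ 1 (k + b) i))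
             (cong (_++ interval (1 + (k + b)) i) (sym (interval-++ 1 k b)))) ⟩
      ((interval 1 k ++ interval (1 + k) b) ++ interval (1 + k + b) i) ++ holes
        ↭⟨ ++⁺ˡ ((interval 1 k ++ interval (1 + k) b) ++ interval (1 + k + b) i) holes↭ ⟩
      ((interval 1 k ++ interval (1 + k) b) ++ interval (1 + k + b) i) ++ hs ++ hs′
        ↭⟨ solve 5 (λ lo mid hi h h′ → ((lo ∙ mid) ∙ hi) ∙ h ∙ h′ ⊜ (h ∙ lo ∙ hi) ∙ mid ∙ h′) ↭-refl
             (interval 1 k) (interval (1 + k) b) (interval (1 + k + b) i) hs hs′ ⟩
      A ++ B ∎
      where
      open PermutationReasoning
      open ListSolver using (solve; _⊜_) renaming (_⊕_ to _∙_)

    free-↭ : free ↭ 3 + r ∷ 1 ∷ 2 + r ∷ A ++ B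
    free-↭ = begin
      interval 0 ℓ ++ holes                        ≡⟨ cong (λ ℓ → interval 0 ℓ ++ holes) ℓ≡ ⟩
      interval 0 (3 + r) ++ holes                  ↭⟨ ++⁺ʳ holes low-↭ ⟩
      3 + r ∷ 1 ∷ 2 + r ∷ interval 1 r ++ holes    ↭⟨ ++⁺ˡ (3 + r ∷ 1 ∷ 2 + r ∷ []) split ⟩
      3 + r ∷ 1 ∷ 2 + r ∷ A ++ B                   ∎
      where open PermutationReasoning

  2*x : 2 * x ≡ 2 * ℓ + (2 * sum hs + k * (k + 3) + i * (2 * k + 2 * b + i + 3))
  2*x = begin
    2 * (ℓ + sum A)
      ≡⟨ cong (λ s → 2 * (ℓ + s)) (trans (sum-++ hs _) (cong (sum hs +_) (sum-++ (interval 1 k) _))) ⟩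
    2 * (ℓ + (sum hs + (sum (interval 1 k) + sum (interval (1 + k + b) i))))
      ≡⟨ lemma₁ ℓ (sum hs) (sum (interval 1 k)) (sum (interval (1 + k + b) i)) ⟩
    2 * ℓ + (2 * sum hs + 2 * sum (interval 1 k) + 2 * sum (interval (1 + k + b) i))
      ≡⟨ cong₂ (λ s t → 2 * ℓ + (2 * sum hs + s + t)) (2*sum-interval 1 k) (2*sum-interval (1 + k + b) i) ⟩
    2 * ℓ + (2 * sum hs + k * (2 * 1 + suc k) + i * (2 * (1 + k + b) + suc i))
      ≡⟨ lemma₂ k b i ℓ (sum hs) ⟩
    2 * ℓ + (2 * sum hs + k * (k + 3) + i * (2 * k + 2 * b + i + 3)) ∎
    where
    open ≡-Reasoning
    lemma₁ : ∀ ℓ h s t → 2 * (ℓ + (h + (s + t))) ≡ 2 * ℓ + (2 * h + 2 * s + 2 * t)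
    lemma₁ = solve-∀
    lemma₂ : ∀ k b i ℓ h → 2 * ℓ + (2 * h + k * (2 * 1 + suc k) + i * (2 * (1 + k + b) + suc i)) ≡
      2 * ℓ + (2 * h + k * (k + 3) + i * (2 * k + 2 * b + i + 3))
    lemma₂ = solve-∀

  2*y : 2 * y ≡ 2 * ℓ + (2 * sum hs′ + b * (2 * k + b + 3))
  2*y = begin
    2 * (ℓ + sum B)
      ≡⟨ cong (λ s → 2 * (ℓ + s)) (sum-++ (interval (1 + k) b) hs′) ⟩
    2 * (ℓ + (sum (interval (1 + k) b) + sum hs′))
      ≡⟨ lemma₁ ℓ (sum (interval (1 + k) b)) (sum hs′) ⟩
    2 * ℓ + (2 * sum hs′ + 2 * sum (interval (1 + k) b))
      ≡⟨ cong (λ s → 2 * ℓ + (2 * sum hs′ + s)) (2*sum-interval (1 + k) b) ⟩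
    2 * ℓ + (2 * sum hs′ + b * (2 * (1 + k) + suc b))
      ≡⟨ lemma₂ k b ℓ (sum hs′) ⟩
    2 * ℓ + (2 * sum hs′ + b * (2 * k + b + 3)) ∎
    where
    open ≡-Reasoning
    lemma₁ : ∀ ℓ s h → 2 * (ℓ + (s + h)) ≡ 2 * ℓ + (2 * h + 2 * s)
    lemma₁ = solve-∀
    lemma₂ : ∀ k b ℓ h → 2 * ℓ + (2 * h + b * (2 * (1 + k) + suc b)) ≡ 2 * ℓ + (2 * h + b * (2 * k + b + 3))
    lemma₂ = solve-∀

  length-A : length A ≡ length hs + (k + i)
  length-A = trans (length-++ hs) (cong (length hs +_)
    (trans (length-++ (interval 1 k)) (cong₂ _+_ (length-interval 1 k) (length-interval (1 + k + b) i))))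

  length-B : length B ≡ b + length hs′
  length-B = trans (length-++ (interval (1 + k) b)) (cong (_+ length hs′) (length-interval (1 + k) b))

  module _ {a b′ c} (a≡ : length hs + (k + i) ≡ a) (b≡ : b + length hs′ ≡ b′) (c≡ : k₁ + k₂ ≡ c) where

    private
      familyLabeling : M < x → M < y → x ≢ y → x ∉ centers rungs → y ∉ centers rungs → Labeling a b′ (suc c)
      familyLabeling M<x M<y x≢y x∉ y∉ = subst₂ (λ a b → Labeling a b (suc c)) (trans length-A a≡) (trans length-B b≡)
        (subst (λ c → Labeling (length A) (length B) (suc c)) c≡
          (layout⇒labeling lay valid 1 (2 + r) A B free-↭
            (subst (λ ℓ → M < ℓ + sum A) ℓ≡ M<x) (subst (λ ℓ → M < ℓ + sum B) ℓ≡ M<y)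
            (subst (λ ℓ → ℓ + sum A ≢ ℓ + sum B) ℓ≡ x≢y)
            (subst (λ ℓ → ℓ + sum A ∉ centers rungs) ℓ≡ x∉) (subst (λ ℓ → ℓ + sum B ∉ centers rungs) ℓ≡ y∉)))

    -- `R` bounds the sums of both ladders, so x and y clash with nothing once R < x < y. The
    -- conditions are doubled to fit the closed forms of 2x and 2y.
    aboveRungs : ∀ R → M ≤ R → ℓ + H₂ + 2 * k₁ ≤ R → L₂ + H₁ + 2 * k₂ ≤ R →
      2 * R < 2 * ℓ + (2 * sum hs + k * (k + 3) + i * (2 * k + 2 * b + i + 3)) →
      2 * sum hs + k * (k + 3) + i * (2 * k + 2 * b + i + 3) < 2 * sum hs′ + b * (2 * k + b + 3) →
      Labeling a b′ (suc c)
    aboveRungs R M≤R R₁ R₂ 2R<2x 2x<2y =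
      familyLabeling (≤-<-trans M≤R R<x) (≤-<-trans M≤R (<-trans R<x x<y)) (<⇒≢ x<y)
        (λ x∈ → <⇒≱ R<x (rungs-≤ R₁ R₂ x∈)) (λ y∈ → <⇒≱ (<-trans R<x x<y) (rungs-≤ R₁ R₂ y∈))
      where
      R<x : R < x
      R<x = *-cancelˡ-< 2 R x (subst (2 * R <_) (sym 2*x) 2R<2x)
      x<y : x < y
      x<y = *-cancelˡ-< 2 x y (subst₂ _<_ (sym 2*x) (sym 2*y) (+-monoʳ-< (2 * ℓ) 2x<2y))

    -- Meant for a single leaf at x: one label need not lift x over the last rung, so x is put
    -- between M and the first rung, and only y goes beyond R.
    belowRungs : ∀ R → M < x → x < suc (suc (ℓ + H₂)) → x < suc (suc (L₂ + H₁)) →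
      ℓ + H₂ + 2 * k₁ ≤ R → L₂ + H₁ + 2 * k₂ ≤ R → x ≤ R →
      2 * R < 2 * ℓ + (2 * sum hs′ + b * (2 * k + b + 3)) → Labeling a b′ (suc c)
    belowRungs R M<x x<₁ x<₂ R₁ R₂ x≤R 2R<2y = familyLabeling M<x (<-trans M<x x<y) (<⇒≢ x<y)
      (λ x∈ → <-irrefl refl (rungs-≥ x<₁ x<₂ x∈)) (λ y∈ → <⇒≱ R<y (rungs-≤ R₁ R₂ y∈))
      where
      R<y : R < y
      R<y = *-cancelˡ-< 2 R y (subst (2 * R <_) (sym 2*y) 2R<2y)
      x<y : x < y
      x<y = ≤-<-trans x≤R R<y

≤-by : ∀ {l r} d → r ≡ l + d → l ≤ r
≤-by {l} d eq = subst (l ≤_) (sym eq) (m≤m+n l d)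

-- A certificate for deducing L ≤ R from n ≤ m: `e` and `d` are slacks, and the two equations are
-- left to the ring solver.
linear-≤ : ∀ {n m L R} → n ≤ m → ∀ c s d e → L + e ≡ s + c * n → R ≡ s + c * m + d → L ≤ R
linear-≤ {n} {m} {L} {R} n≤m c s d e eqL eqR = begin
  L              ≤⟨ m≤m+n L e ⟩
  L + e          ≡⟨ eqL ⟩
  s + c * n      ≤⟨ +-monoʳ-≤ s (*-monoʳ-≤ c n≤m) ⟩
  s + c * m      ≤⟨ m≤m+n (s + c * m) d ⟩
  s + c * m + d  ≡⟨ eqR ⟨
  R              ∎
  where open ≤-Reasoning

-- Here 2 (R - L) = u² - p u - c + E, and u² dominates p u + c for u ≥ t.
quadratic-< : ∀ {L R} u t p s c E → 2 * R + (p * u + c) ≡ 2 * L + (u * u + E) → t ≤ u → p + s ≤ t → c < s * t → L < R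
quadratic-< {L} {R} u t p s c E eq t≤u p+s≤t c<st = *-cancelˡ-< 2 L R (+-cancelʳ-< (p * u + c) (2 * L) (2 * R) (begin-strict
  2 * L + (p * u + c)        <⟨ +-monoʳ-< (2 * L) (+-monoʳ-< (p * u) (<-≤-trans c<st (*-monoʳ-≤ s t≤u))) ⟩
  2 * L + (p * u + s * u)    ≡⟨ cong (2 * L +_) (*-distribʳ-+ u p s) ⟨
  2 * L + (p + s) * u        ≤⟨ +-monoʳ-≤ (2 * L) (*-monoˡ-≤ u (≤-trans p+s≤t t≤u)) ⟩
  2 * L + u * u              ≤⟨ +-monoʳ-≤ (2 * L) (m≤m+n (u * u) E) ⟩
  2 * L + (u * u + E)        ≡⟨ eq ⟨
  2 * R + (p * u + c)        ∎))
  where open ≤-Reasoning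

-- a = 1 and an odd number of paths: the leaf edge at x gets the hole of the layout.
oneLeaf-odd : ∀ b n ℓ → ℓ ≡ 3 + (0 + b + 0) → 37 ≤ b → n < ℓ → Labeling 1 b (suc (n + n))
oneLeaf-odd b n ℓ ℓ≡ 37≤b n<ℓ = belowRungs refl (+-identityʳ b) refl (2 * ℓ + 5 * n + 1)
  (linear-≤ n<ℓ 1 (ℓ + 3 * n + 1) 0 0 (eq₁ ℓ n) (eq₂ ℓ n))
  -- The second ladder starts at x + 1 and the first at x + 2.
  (≤-by 1 (eq₃ ℓ n)) (≤-reflexive (eq₄ ℓ n)) (≤-reflexive (eq₅ ℓ n)) (≤-by 1 (eq₆ ℓ n)) (≤-by (2 * n) (eq₇ ℓ n))
  (≤-<-trans (linear-≤ n<ℓ 10 (4 * ℓ) 0 8 (eq₈ ℓ n) refl)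
    (≤-<-trans (≤-reflexive (eq₉ ℓ)) (+-monoʳ-< (2 * ℓ) (subst (λ ℓ → 12 * ℓ < b * (b + 3)) (sym ℓ≡)
      (quadratic-< b 37 18 19 72 (b * b) (eq₁₀ b) 37≤b ≤-refl (<ᵇ⇒< 72 703 _))))))
  where
  lay = layout ℓ 0 0 1 0 n n
  eq₁ : ∀ ℓ n → suc (ℓ + n + 0 + n + 0 + n + 1 + n + 0) + 0 ≡ ℓ + 3 * n + 1 + 1 * suc n
  eq₁ = solve-∀
  valid : Layout.Valid lay
  valid = record { half = n ; odd = odd n
    ; large₁ = linear-≤ n<ℓ 1 (ℓ + 3 * n + 1) 2 0 (eq₁ ℓ n) (large₁ ℓ n)
    ; large₂ = linear-≤ n<ℓ 1 (ℓ + 3 * n + 1) 1 0 (eq₁ ℓ n) (large₂ ℓ n) }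
    where
    odd : ∀ n → n + 0 + (n + 1) ≡ suc (2 * n)
    odd = solve-∀
    large₁ : ∀ ℓ n → suc (suc (ℓ + (ℓ + n + 0 + n + 0 + n + 1))) ≡ ℓ + 3 * n + 1 + 1 * ℓ + 2
    large₁ = solve-∀
    large₂ : ∀ ℓ n → suc (suc (ℓ + n + 0 + (ℓ + n + 0 + n + 0))) ≡ ℓ + 3 * n + 1 + 1 * ℓ + 1
    large₂ = solve-∀
  open Family lay valid 0 b 0 (suc (Layout.g₃ lay) ∷ []) [] ℓ≡ ↭-refl
  eq₂ : ∀ ℓ n → ℓ + (suc (ℓ + n + 0 + n + 0 + n) + 0) ≡ ℓ + 3 * n + 1 + 1 * ℓ + 0
  eq₂ = solve-∀
  eq₃ : ∀ ℓ n → suc (suc (ℓ + (ℓ + n + 0 + n + 0 + n + 1))) ≡ suc (ℓ + (suc (ℓ + n + 0 + n + 0 + n) + 0)) + 1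
  eq₃ = solve-∀
  eq₄ : ∀ ℓ n → suc (ℓ + (suc (ℓ + n + 0 + n + 0 + n) + 0)) ≡ suc (suc (ℓ + n + 0 + (ℓ + n + 0 + n + 0)))
  eq₄ = solve-∀
  eq₅ : ∀ ℓ n → ℓ + (ℓ + n + 0 + n + 0 + n + 1) + 2 * n ≡ 2 * ℓ + 5 * n + 1
  eq₅ = solve-∀
  eq₆ : ∀ ℓ n → 2 * ℓ + 5 * n + 1 ≡ ℓ + n + 0 + (ℓ + n + 0 + n + 0) + 2 * n + 1
  eq₆ = solve-∀
  eq₇ : ∀ ℓ n → 2 * ℓ + 5 * n + 1 ≡ ℓ + (suc (ℓ + n + 0 + n + 0 + n) + 0) + 2 * n
  eq₇ = solve-∀
  eq₈ : ∀ ℓ n → 2 * (2 * ℓ + 5 * n + 1) + 8 ≡ 4 * ℓ + 10 * suc n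
  eq₈ = solve-∀
  eq₉ : ∀ ℓ → 4 * ℓ + 10 * ℓ + 0 ≡ 2 * ℓ + 12 * ℓ
  eq₉ = solve-∀
  eq₁₀ : ∀ b → 2 * (b * (b + 3)) + (18 * b + 72) ≡ 2 * (12 * (3 + (0 + b + 0))) + (b * b + b * b)
  eq₁₀ = solve-∀

-- a = 1 and an even number of paths: one hole goes to each centre of the double star.
oneLeaf-even : ∀ b n ℓ → ℓ ≡ 3 + (0 + b + 0) → 36 ≤ b → n < ℓ → Labeling 1 (suc b) (suc (suc (n + n)))
oneLeaf-even b n ℓ ℓ≡ 36≤b n<ℓ = belowRungs refl (+-comm b 1) (+-suc n n) (2 * ℓ + 5 * n + 5)
  (linear-≤ n<ℓ 1 (ℓ + 3 * n + 4) 0 0 (eq₁ ℓ n) (eq₂ ℓ n))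
  (≤-by 1 (eq₃ ℓ n)) (≤-reflexive (eq₄ ℓ n)) (≤-by 1 (eq₅ ℓ n)) (≤-reflexive (eq₆ ℓ n)) (≤-by (2 * n + 1) (eq₇ ℓ n))
  (≤-<-trans (linear-≤ n<ℓ 8 (4 * ℓ + 2 * n + 2) 0 0 (eq₈ ℓ n) refl)
    (≤-<-trans (≤-reflexive (eq₉ ℓ n)) (+-monoʳ-< (2 * ℓ) (+-monoʳ-< (2 * (suc (ℓ + n) + 0))
      (subst (λ ℓ → 8 * ℓ < b * (b + 3)) (sym ℓ≡)
        (quadratic-< b 36 10 26 48 (b * b) (eq₁₀ b) 36≤b ≤-refl (<ᵇ⇒< 48 936 _)))))))
  where
  lay = layout ℓ 1 0 1 0 n (suc n)
  valid : Layout.Valid lay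
  valid = record { half = suc n ; odd = odd n
    ; large₁ = linear-≤ n<ℓ 1 (ℓ + 3 * n + 4) 2 0 (size ℓ n) (large₁ ℓ n)
    ; large₂ = linear-≤ n<ℓ 1 (ℓ + 3 * n + 4) 1 0 (size ℓ n) (large₂ ℓ n) }
    where
    odd : ∀ n → n + 1 + (suc n + 1) ≡ suc (2 * suc n)
    odd = solve-∀
    size : ∀ ℓ n → suc (ℓ + n + 1 + suc n + 0 + suc n + 1 + n + 0) + 0 ≡ ℓ + 3 * n + 4 + 1 * suc n
    size = solve-∀
    large₁ : ∀ ℓ n → suc (suc (ℓ + (ℓ + n + 1 + suc n + 0 + suc n + 1))) ≡ ℓ + 3 * n + 4 + 1 * ℓ + 2
    large₁ = solve-∀
    large₂ : ∀ ℓ n → suc (suc (ℓ + n + 1 + (ℓ + n + 1 + suc n + 0))) ≡ ℓ + 3 * n + 4 + 1 * ℓ + 1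
    large₂ = solve-∀
  open Family lay valid 0 b 0 (suc (Layout.g₃ lay) ∷ []) (suc (Layout.g₁ lay) ∷ []) ℓ≡ (↭-swap _ _ ↭-refl)
  eq₁ : ∀ ℓ n → suc (ℓ + n + 1 + suc n + 0 + suc n + 1 + n + 0) + 0 ≡ ℓ + 3 * n + 4 + 1 * suc n
  eq₁ = solve-∀
  eq₂ : ∀ ℓ n → ℓ + (suc (ℓ + n + 1 + suc n + 0 + suc n) + 0) ≡ ℓ + 3 * n + 4 + 1 * ℓ + 0
  eq₂ = solve-∀
  eq₃ : ∀ ℓ n → suc (suc (ℓ + (ℓ + n + 1 + suc n + 0 + suc n + 1))) ≡ suc (ℓ + (suc (ℓ + n + 1 + suc n + 0 + suc n) + 0)) + 1
  eq₃ = solve-∀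
  eq₄ : ∀ ℓ n → suc (ℓ + (suc (ℓ + n + 1 + suc n + 0 + suc n) + 0)) ≡ suc (suc (ℓ + n + 1 + (ℓ + n + 1 + suc n + 0)))
  eq₄ = solve-∀
  eq₅ : ∀ ℓ n → 2 * ℓ + 5 * n + 5 ≡ ℓ + (ℓ + n + 1 + suc n + 0 + suc n + 1) + 2 * n + 1
  eq₅ = solve-∀
  eq₆ : ∀ ℓ n → ℓ + n + 1 + (ℓ + n + 1 + suc n + 0) + 2 * suc n ≡ 2 * ℓ + 5 * n + 5
  eq₆ = solve-∀
  eq₇ : ∀ ℓ n → 2 * ℓ + 5 * n + 5 ≡ ℓ + (suc (ℓ + n + 1 + suc n + 0 + suc n) + 0) + (2 * n + 1)
  eq₇ = solve-∀
  eq₈ : ∀ ℓ n → 2 * (2 * ℓ + 5 * n + 5) + 0 ≡ 4 * ℓ + 2 * n + 2 + 8 * suc n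
  eq₈ = solve-∀
  eq₉ : ∀ ℓ n → 4 * ℓ + 2 * n + 2 + 8 * ℓ + 0 ≡ 2 * ℓ + (2 * (suc (ℓ + n) + 0) + 8 * ℓ)
  eq₉ = solve-∀
  eq₁₀ : ∀ b → 2 * (b * (b + 3)) + (10 * b + 48) ≡ 2 * (8 * (3 + (0 + b + 0))) + (b * b + b * b)
  eq₁₀ = solve-∀

-- a ≥ 2: two holes go to x, together with the smallest remaining labels.
module TwoHoles (k b d ℓ : ℕ) (b≡ : b ≡ 2 + k + d) (ℓ≡ : ℓ ≡ 3 + (k + b + 0)) (34≤u : 34 ≤ 2 * k + d) where

  -- The bound 7ℓ + 3 holds for the sums of both pairs of holes below, as n ≤ ℓ; the variable of the
  -- quadratic estimate is u = 2k + d = a + b - 4.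
  x<y : ∀ h → h ≤ 7 * ℓ + 3 → 2 * h + k * (k + 3) + 0 < b * (2 * k + b + 3)
  x<y h h≤ = ≤-<-trans (+-monoˡ-≤ 0 (+-monoˡ-≤ (k * (k + 3)) (*-monoʳ-≤ 2 h≤)))
    (subst (λ ℓ → 2 * (7 * ℓ + 3) + k * (k + 3) + 0 < b * (2 * k + b + 3)) (sym ℓ≡)
      (subst (λ b → 2 * (7 * (3 + (k + b + 0)) + 3) + k * (k + 3) + 0 < b * (2 * k + b + 3)) (sym b≡)
        (quadratic-< (2 * k + d) 34 20 14 132 (4 * d * k + d * d + 6 * d) (eq k d) 34≤u ≤-refl (<ᵇ⇒< 132 476 _))))
    where
    eq : ∀ k d → 2 * ((2 + k + d) * (2 * k + (2 + k + d) + 3)) + (20 * (2 * k + d) + 132) ≡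
      2 * (2 * (7 * (3 + (k + (2 + k + d) + 0)) + 3) + k * (k + 3) + 0) +
      ((2 * k + d) * (2 * k + d) + (4 * d * k + d * d + 6 * d))
    eq = solve-∀

  twoHoles-odd : ∀ n → n ≤ ℓ → Labeling (2 + k) b (suc (n + n))
  twoHoles-odd n n≤ℓ = aboveRungs (cong (2 +_) (+-identityʳ k)) (+-identityʳ b) refl (2 * ℓ + 5 * n + 2)
    (≤-by (ℓ + n) (eq₁ ℓ n)) (≤-by 1 (eq₂ ℓ n)) (≤-reflexive (eq₃ ℓ n))
    (≤-by (2 * ℓ + 1 + k * (k + 3)) (eq₄ k ℓ n))
    (x<y _ (linear-≤ n≤ℓ 5 (2 * ℓ + 3) 0 0 (eq₅ ℓ n) (eq₆ ℓ)))
    where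
    lay = layout ℓ 1 0 0 1 n n
    valid : Layout.Valid lay
    valid = record { half = n ; odd = odd n
      ; large₁ = linear-≤ n≤ℓ 1 (ℓ + 3 * n + 3) 0 0 (size ℓ n) (large₁ ℓ n)
      ; large₂ = linear-≤ n≤ℓ 1 (ℓ + 3 * n + 3) 1 0 (size ℓ n) (large₂ ℓ n) }
      where
      odd : ∀ n → n + 1 + (n + 0) ≡ suc (2 * n)
      odd = solve-∀
      size : ∀ ℓ n → suc (ℓ + n + 1 + n + 0 + n + 0 + n + 1) + 0 ≡ ℓ + 3 * n + 3 + 1 * n
      size = solve-∀
      large₁ : ∀ ℓ n → suc (suc (ℓ + (ℓ + n + 1 + n + 0 + n + 0))) ≡ ℓ + 3 * n + 3 + 1 * ℓ + 0
      large₁ = solve-∀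
      large₂ : ∀ ℓ n → suc (suc (ℓ + n + 1 + (ℓ + n + 1 + n + 0))) ≡ ℓ + 3 * n + 3 + 1 * ℓ + 1
      large₂ = solve-∀
    open Family lay valid k b 0 (suc (Layout.g₁ lay) ∷ suc (Layout.g₄ lay) ∷ []) [] ℓ≡ ↭-refl
    eq₁ : ∀ ℓ n → 2 * ℓ + 5 * n + 2 ≡ ℓ + n + 1 + n + 0 + n + 0 + n + 1 + (ℓ + n)
    eq₁ = solve-∀
    eq₂ : ∀ ℓ n → 2 * ℓ + 5 * n + 2 ≡ ℓ + (ℓ + n + 1 + n + 0 + n + 0) + 2 * n + 1
    eq₂ = solve-∀
    eq₃ : ∀ ℓ n → ℓ + n + 1 + (ℓ + n + 1 + n + 0) + 2 * n ≡ 2 * ℓ + 5 * n + 2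
    eq₃ = solve-∀
    eq₄ : ∀ k ℓ n → 2 * ℓ + (2 * (suc (ℓ + n) + (suc (ℓ + n + 1 + n + 0 + n + 0 + n) + 0)) + k * (k + 3) + 0) ≡
      suc (2 * (2 * ℓ + 5 * n + 2)) + (2 * ℓ + 1 + k * (k + 3))
    eq₄ = solve-∀
    eq₅ : ∀ ℓ n → suc (ℓ + n) + (suc (ℓ + n + 1 + n + 0 + n + 0 + n) + 0) + 0 ≡ 2 * ℓ + 3 + 5 * n
    eq₅ = solve-∀
    eq₆ : ∀ ℓ → 7 * ℓ + 3 ≡ 2 * ℓ + 3 + 5 * ℓ + 0
    eq₆ = solve-∀

  -- The sum at x passes R as long as n < ℓ + k(k + 3)/2. The linear condition n < ℓ + k suffices
  -- and admits n = ℓ = m, that is 2m + 2 paths, as soon as k ≥ 1, that is a ≥ 3.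
  twoHoles-even : ∀ n → n ≤ ℓ → n < ℓ + k → Labeling (2 + k) b (suc (suc (n + n)))
  twoHoles-even n n≤ℓ n<ℓ+k = aboveRungs (cong (2 +_) (+-identityʳ k)) (+-identityʳ b) refl (2 * ℓ + 5 * n + 5)
    (≤-by (ℓ + n + 1) (eq₁ ℓ n)) (≤-reflexive (eq₂ ℓ n)) (≤-by 1 (eq₃ ℓ n))
    (linear-≤ n<ℓ+k 2 (4 * ℓ + 8 * n + 10) (k * k + k) 1 (eq₄ ℓ n) (eq₅ k ℓ n))
    (x<y _ (linear-≤ n≤ℓ 4 (2 * ℓ + 5) (ℓ ∸ 2) 0 (eq₆ ℓ n) (trans (cong (λ t → 7 * t + 3) ℓ∸2) (trans (eq₇ (ℓ ∸ 2))
      (cong (λ t → 2 * t + 5 + 4 * t + (ℓ ∸ 2)) (sym ℓ∸2))))))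
    where
    ℓ∸2 : ℓ ≡ 2 + (ℓ ∸ 2)
    ℓ∸2 = sym (m+[n∸m]≡n {2} {ℓ} (subst (2 ≤_) (sym ℓ≡) (s≤s (s≤s z≤n))))
    lay = layout ℓ 1 0 1 0 (suc n) n
    valid : Layout.Valid lay
    valid = record { half = suc n ; odd = odd n
      ; large₁ = linear-≤ n≤ℓ 1 (ℓ + 3 * n + 5) 0 0 (size ℓ n) (large₁ ℓ n)
      ; large₂ = linear-≤ n≤ℓ 1 (ℓ + 3 * n + 5) 1 0 (size ℓ n) (large₂ ℓ n) }
      where
      odd : ∀ n → suc n + 1 + (n + 1) ≡ suc (2 * suc n)
      odd = solve-∀
      size : ∀ ℓ n → suc (ℓ + suc n + 1 + n + 0 + n + 1 + suc n + 0) + 0 ≡ ℓ + 3 * n + 5 + 1 * n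
      size = solve-∀
      large₁ : ∀ ℓ n → suc (suc (ℓ + (ℓ + suc n + 1 + n + 0 + n + 1))) ≡ ℓ + 3 * n + 5 + 1 * ℓ + 0
      large₁ = solve-∀
      large₂ : ∀ ℓ n → suc (suc (ℓ + suc n + 1 + (ℓ + suc n + 1 + n + 0))) ≡ ℓ + 3 * n + 5 + 1 * ℓ + 1
      large₂ = solve-∀
    open Family lay valid k b 0 (suc (Layout.g₁ lay) ∷ suc (Layout.g₃ lay) ∷ []) [] ℓ≡ ↭-refl
    eq₁ : ∀ ℓ n → 2 * ℓ + 5 * n + 5 ≡ ℓ + suc n + 1 + n + 0 + n + 1 + suc n + 0 + (ℓ + n + 1)
    eq₁ = solve-∀
    eq₂ : ∀ ℓ n → ℓ + (ℓ + suc n + 1 + n + 0 + n + 1) + 2 * suc n ≡ 2 * ℓ + 5 * n + 5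
    eq₂ = solve-∀
    eq₃ : ∀ ℓ n → 2 * ℓ + 5 * n + 5 ≡ ℓ + suc n + 1 + (ℓ + suc n + 1 + n + 0) + 2 * n + 1
    eq₃ = solve-∀
    eq₄ : ∀ ℓ n → suc (2 * (2 * ℓ + 5 * n + 5)) + 1 ≡ 4 * ℓ + 8 * n + 10 + 2 * suc n
    eq₄ = solve-∀
    eq₅ : ∀ k ℓ n → 2 * ℓ + (2 * (suc (ℓ + suc n) + (suc (ℓ + suc n + 1 + n + 0 + n) + 0)) + k * (k + 3) + 0) ≡
      4 * ℓ + 8 * n + 10 + 2 * (ℓ + k) + (k * k + k)
    eq₅ = solve-∀
    eq₆ : ∀ ℓ n → suc (ℓ + suc n) + (suc (ℓ + suc n + 1 + n + 0 + n) + 0) + 0 ≡ 2 * ℓ + 5 + 4 * n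
    eq₆ = solve-∀
    eq₇ : ∀ t → 7 * (2 + t) + 3 ≡ 2 * (2 + t) + 5 + 4 * (2 + t) + t
    eq₇ = solve-∀

-- c = 2 m + i: a hole of the layout (none for i = 6) and the largest remaining labels go to x.
module TopLabels (k b d m : ℕ) where

  -- The hole `suc g₃` is 4m + 5, and the sums of the ladders are exactly M + 1, ..., M + 2m + 2.
  topLabels-3 : b ≡ 4 + k + d → suc m ≡ 3 + (k + b + 3) → 34 ≤ k + b → 30 ≤ 2 * k + d →
    Labeling (4 + k) b (suc (suc m + suc m))
  topLabels-3 b≡ ℓ≡ 34≤k+b 30≤u = aboveRungs (cong suc (+-comm k 3)) (+-identityʳ b) refl (7 * m + 8)
    (≤-by (2 * m + 2) (bound m)) (≤-reflexive (sym (rung₁ m))) (≤-by 1 (rung₂ m))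
    (subst (λ m → 2 * (7 * m + 8) < 2 * (suc m) + (2 * (suc (suc m + suc m + 0 + suc m + 0 + suc m) + 0) + k * (k + 3) + 3 * (2 * k + 2 * b + 3 + 3))) (sym m≡)
      (linear-≤ 34≤k+b 2 (14 * (k + b) + 80) (k * (k + 3)) 61 (x-large₁ k b) (x-large₂ k b)))
    (subst (λ m → 2 * (suc (suc m + suc m + 0 + suc m + 0 + suc m) + 0) + k * (k + 3) + 3 * (2 * k + 2 * b + 3 + 3) < b * (2 * k + b + 3)) (sym m≡)
      (subst (λ b → let m = 2 + (k + b + 3) in 2 * (suc (suc m + suc m + 0 + suc m + 0 + suc m) + 0) + k * (k + 3) + 3 * (2 * k + 2 * b + 3 + 3) < b * (2 * k + b + 3)) (sym b≡)
        (quadratic-< (2 * k + d) 30 12 18 192 (4 * d * k + d * d + 6 * d) (x<y k d) 30≤u ≤-refl (<ᵇ⇒< 192 540 _))))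
    where
    m≡ : m ≡ 2 + (k + b + 3)
    m≡ = suc-injective ℓ≡
    lay = layout (suc m) 0 0 1 0 (suc m) (suc m)
    valid : Layout.Valid lay
    valid = record { half = suc m ; odd = odd m ; large₁ = ≤-by 1 (large₁ m) ; large₂ = ≤-reflexive (sym (large₂ m)) }
      where
      odd : ∀ m → suc m + 0 + (suc m + 1) ≡ suc (2 * (suc m))
      odd = solve-∀
      large₁ : ∀ m → suc (suc (suc m + (suc m + suc m + 0 + suc m + 0 + suc m + 1))) ≡ suc (suc m + suc m + 0 + suc m + 0 + suc m + 1 + suc m + 0) + 1
      large₁ = solve-∀
      large₂ : ∀ m → suc (suc (suc m + suc m + 0 + (suc m + suc m + 0 + suc m + 0))) ≡ suc (suc m + suc m + 0 + suc m + 0 + suc m + 1 + suc m + 0)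
      large₂ = solve-∀
    open Family lay valid k b 3 (suc (Layout.g₃ lay) ∷ []) [] ℓ≡ ↭-refl
    bound : ∀ m → 7 * m + 8 ≡ suc m + suc m + 0 + suc m + 0 + suc m + 1 + suc m + 0 + (2 * m + 2)
    bound = solve-∀
    rung₁ : ∀ m → 7 * m + 8 ≡ suc m + (suc m + suc m + 0 + suc m + 0 + suc m + 1) + 2 * (suc m)
    rung₁ = solve-∀
    rung₂ : ∀ m → 7 * m + 8 ≡ suc m + suc m + 0 + (suc m + suc m + 0 + suc m + 0) + 2 * (suc m) + 1
    rung₂ = solve-∀
    x-large₁ : ∀ k b → let m = 2 + (k + b + 3) in suc (2 * (7 * m + 8)) + 61 ≡ 14 * (k + b) + 80 + 2 * 34
    x-large₁ = solve-∀
    x-large₂ : ∀ k b → let m = 2 + (k + b + 3) in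
      2 * (suc m) + (2 * (suc (suc m + suc m + 0 + suc m + 0 + suc m) + 0) + k * (k + 3) + 3 * (2 * k + 2 * b + 3 + 3)) ≡
      14 * (k + b) + 80 + 2 * (k + b) + k * (k + 3)
    x-large₂ = solve-∀
    x<y : ∀ k d → let b = 4 + k + d ; m = 2 + (k + b + 3) in
      2 * (b * (2 * k + b + 3)) + (12 * (2 * k + d) + 192) ≡
      2 * (2 * (suc (suc m + suc m + 0 + suc m + 0 + suc m) + 0) + k * (k + 3) + 3 * (2 * k + 2 * b + 3 + 3)) + ((2 * k + d) * (2 * k + d) + (4 * d * k + d * d + 6 * d))
    x<y = solve-∀

  topLabels-4 : b ≡ 5 + k + d → suc m ≡ 3 + (k + b + 4) → 33 ≤ k + b → 28 ≤ 2 * k + d →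
    Labeling (5 + k) b (suc (suc (suc m) + suc m))
  topLabels-4 b≡ ℓ≡ 33≤k+b 28≤u = aboveRungs (cong suc (+-comm k 4)) (+-identityʳ b) refl (7 * m + 11)
    (≤-by (2 * m + 3) (bound m)) (≤-reflexive (sym (rung₁ m))) (≤-by 1 (rung₂ m))
    (subst (λ m → 2 * (7 * m + 11) < 2 * (suc m) + (2 * (suc (suc m + suc (suc m) + 0 + suc m) + 0) + k * (k + 3) + 4 * (2 * k + 2 * b + 4 + 3))) (sym m≡)
      (linear-≤ 33≤k+b 2 (14 * (k + b) + 88) (k * (k + 3)) 47 (x-large₁ k b) (x-large₂ k b)))
    (subst (λ m → 2 * (suc (suc m + suc (suc m) + 0 + suc m) + 0) + k * (k + 3) + 4 * (2 * k + 2 * b + 4 + 3) < b * (2 * k + b + 3)) (sym m≡)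
      (subst (λ b → let m = 2 + (k + b + 4) in 2 * (suc (suc m + suc (suc m) + 0 + suc m) + 0) + k * (k + 3) + 4 * (2 * k + 2 * b + 4 + 3) < b * (2 * k + b + 3)) (sym b≡)
        (quadratic-< (2 * k + d) 28 8 20 208 (4 * d * k + d * d + 6 * d) (x<y k d) 28≤u ≤-refl (<ᵇ⇒< 208 560 _))))
    where
    m≡ : m ≡ 2 + (k + b + 4)
    m≡ = suc-injective ℓ≡
    lay = layout (suc m) 0 1 0 0 (suc (suc m)) (suc m)
    valid : Layout.Valid lay
    valid = record { half = suc m ; odd = odd m ; large₁ = ≤-reflexive (sym (large₁ m)) ; large₂ = ≤-by 1 (large₂ m) }
      where
      odd : ∀ m → suc (suc m) + 0 + (suc m + 0) ≡ suc (2 * (suc m))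
      odd = solve-∀
      large₁ : ∀ m → suc (suc (suc m + (suc m + suc (suc m) + 0 + suc m + 1 + suc m + 0))) ≡ suc (suc m + suc (suc m) + 0 + suc m + 1 + suc m + 0 + suc (suc m) + 0)
      large₁ = solve-∀
      large₂ : ∀ m → suc (suc (suc m + suc (suc m) + 0 + (suc m + suc (suc m) + 0 + suc m + 1))) ≡ suc (suc m + suc (suc m) + 0 + suc m + 1 + suc m + 0 + suc (suc m) + 0) + 1
      large₂ = solve-∀
    open Family lay valid k b 4 (suc (Layout.g₂ lay) ∷ []) [] ℓ≡ ↭-refl
    bound : ∀ m → 7 * m + 11 ≡ suc m + suc (suc m) + 0 + suc m + 1 + suc m + 0 + suc (suc m) + 0 + (2 * m + 3)
    bound = solve-∀
    rung₁ : ∀ m → 7 * m + 11 ≡ suc m + (suc m + suc (suc m) + 0 + suc m + 1 + suc m + 0) + 2 * (suc (suc m))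
    rung₁ = solve-∀
    rung₂ : ∀ m → 7 * m + 11 ≡ suc m + suc (suc m) + 0 + (suc m + suc (suc m) + 0 + suc m + 1) + 2 * (suc m) + 1
    rung₂ = solve-∀
    x-large₁ : ∀ k b → let m = 2 + (k + b + 4) in suc (2 * (7 * m + 11)) + 47 ≡ 14 * (k + b) + 88 + 2 * 33
    x-large₁ = solve-∀
    x-large₂ : ∀ k b → let m = 2 + (k + b + 4) in
      2 * (suc m) + (2 * (suc (suc m + suc (suc m) + 0 + suc m) + 0) + k * (k + 3) + 4 * (2 * k + 2 * b + 4 + 3)) ≡
      14 * (k + b) + 88 + 2 * (k + b) + k * (k + 3)
    x-large₂ = solve-∀
    x<y : ∀ k d → let b = 5 + k + d ; m = 2 + (k + b + 4) in
      2 * (b * (2 * k + b + 3)) + (8 * (2 * k + d) + 208) ≡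
      2 * (2 * (suc (suc m + suc (suc m) + 0 + suc m) + 0) + k * (k + 3) + 4 * (2 * k + 2 * b + 4 + 3)) + ((2 * k + d) * (2 * k + d) + (4 * d * k + d * d + 6 * d))
    x<y = solve-∀

  topLabels-5 : b ≡ 6 + k + d → suc m ≡ 3 + (k + b + 5) → 32 ≤ k + b → 26 ≤ 2 * k + d →
    Labeling (6 + k) b (suc (suc (suc m) + suc (suc m)))
  topLabels-5 b≡ ℓ≡ 32≤k+b 26≤u = aboveRungs (cong suc (+-comm k 5)) (+-identityʳ b) refl (7 * m + 14)
    (≤-by (2 * m + 4) (bound m)) (≤-by 1 (rung₁ m)) (≤-reflexive (sym (rung₂ m)))
    (subst (λ m → 2 * (7 * m + 14) < 2 * (suc m) + (2 * (suc (suc m + suc (suc m)) + 0) + k * (k + 3) + 5 * (2 * k + 2 * b + 5 + 3))) (sym m≡)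
      (linear-≤ 32≤k+b 2 (14 * (k + b) + 92) (k * (k + 3)) 29 (x-large₁ k b) (x-large₂ k b)))
    (subst (λ m → 2 * (suc (suc m + suc (suc m)) + 0) + k * (k + 3) + 5 * (2 * k + 2 * b + 5 + 3) < b * (2 * k + b + 3)) (sym m≡)
      (subst (λ b → let m = 2 + (k + b + 5) in 2 * (suc (suc m + suc (suc m)) + 0) + k * (k + 3) + 5 * (2 * k + 2 * b + 5 + 3) < b * (2 * k + b + 3)) (sym b≡)
        (quadratic-< (2 * k + d) 26 4 22 212 (4 * d * k + d * d + 6 * d) (x<y k d) 26≤u ≤-refl (<ᵇ⇒< 212 572 _))))
    where
    m≡ : m ≡ 2 + (k + b + 5)
    m≡ = suc-injective ℓ≡
    lay = layout (suc m) 1 0 0 0 (suc (suc m)) (suc (suc m))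
    valid : Layout.Valid lay
    valid = record { half = suc (suc m) ; odd = odd m ; large₁ = ≤-reflexive (sym (large₁ m)) ; large₂ = ≤-by 1 (large₂ m) }
      where
      odd : ∀ m → suc (suc m) + 1 + (suc (suc m) + 0) ≡ suc (2 * (suc (suc m)))
      odd = solve-∀
      large₁ : ∀ m → suc (suc (suc m + (suc m + suc (suc m) + 1 + suc (suc m) + 0 + suc (suc m) + 0))) ≡ suc (suc m + suc (suc m) + 1 + suc (suc m) + 0 + suc (suc m) + 0 + suc (suc m) + 0)
      large₁ = solve-∀
      large₂ : ∀ m → suc (suc (suc m + suc (suc m) + 1 + (suc m + suc (suc m) + 1 + suc (suc m) + 0))) ≡ suc (suc m + suc (suc m) + 1 + suc (suc m) + 0 + suc (suc m) + 0 + suc (suc m) + 0) + 1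
      large₂ = solve-∀
    open Family lay valid k b 5 (suc (Layout.g₁ lay) ∷ []) [] ℓ≡ ↭-refl
    bound : ∀ m → 7 * m + 14 ≡ suc m + suc (suc m) + 1 + suc (suc m) + 0 + suc (suc m) + 0 + suc (suc m) + 0 + (2 * m + 4)
    bound = solve-∀
    rung₁ : ∀ m → 7 * m + 14 ≡ suc m + (suc m + suc (suc m) + 1 + suc (suc m) + 0 + suc (suc m) + 0) + 2 * (suc (suc m)) + 1
    rung₁ = solve-∀
    rung₂ : ∀ m → 7 * m + 14 ≡ suc m + suc (suc m) + 1 + (suc m + suc (suc m) + 1 + suc (suc m) + 0) + 2 * (suc (suc m))
    rung₂ = solve-∀
    x-large₁ : ∀ k b → let m = 2 + (k + b + 5) in suc (2 * (7 * m + 14)) + 29 ≡ 14 * (k + b) + 92 + 2 * 32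
    x-large₁ = solve-∀
    x-large₂ : ∀ k b → let m = 2 + (k + b + 5) in
      2 * (suc m) + (2 * (suc (suc m + suc (suc m)) + 0) + k * (k + 3) + 5 * (2 * k + 2 * b + 5 + 3)) ≡
      14 * (k + b) + 92 + 2 * (k + b) + k * (k + 3)
    x-large₂ = solve-∀
    x<y : ∀ k d → let b = 6 + k + d ; m = 2 + (k + b + 5) in
      2 * (b * (2 * k + b + 3)) + (4 * (2 * k + d) + 212) ≡
      2 * (2 * (suc (suc m + suc (suc m)) + 0) + k * (k + 3) + 5 * (2 * k + 2 * b + 5 + 3)) + ((2 * k + d) * (2 * k + d) + (4 * d * k + d * d + 6 * d))
    x<y = solve-∀

  -- `StarBound` is an equality for 2m + 6 paths, so there is no room for holes and the ladders fill
  -- M + 1, ..., M + 2m + 5 without gaps. A takes the seven labels just below ℓ - 1, and k + b ≥ 31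
  -- puts x above R.
  topLabels-6 : b ≡ 7 + k + d → suc (suc m) ≡ 3 + (k + b + 7) → 31 ≤ k + b → 24 ≤ 2 * k + d →
    Labeling (7 + k) b (suc (suc (suc (suc m)) + suc (suc m)))
  topLabels-6 b≡ ℓ≡ 31≤k+b 24≤u = aboveRungs (+-comm k 7) (+-identityʳ b) refl (7 * m + 17)
    (≤-by (2 * m + 5) (bound m)) (≤-reflexive (sym (rung₁ m))) (≤-by 1 (rung₂ m))
    (subst (λ m → 2 * (7 * m + 17) < 2 * (suc (suc m)) + (2 * 0 + k * (k + 3) + 7 * (2 * k + 2 * b + 7 + 3))) (sym m≡)
      (linear-≤ 31≤k+b 2 (14 * (k + b) + 90) (k * (k + 3)) 5 (x-large₁ k b) (x-large₂ k b)))
    (subst (λ m → 2 * 0 + k * (k + 3) + 7 * (2 * k + 2 * b + 7 + 3) < b * (2 * k + b + 3)) (sym m≡)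
      (subst (λ b → let m = 1 + (k + b + 7) in 2 * 0 + k * (k + 3) + 7 * (2 * k + 2 * b + 7 + 3) < b * (2 * k + b + 3)) (sym b≡)
        (quadratic-< (2 * k + d) 24 0 24 196 (4 * d * k + d * d + 6 * d) (x<y k d) 24≤u ≤-refl (<ᵇ⇒< 196 576 _))))
    where
    m≡ : m ≡ 1 + (k + b + 7)
    m≡ = suc-injective (suc-injective ℓ≡)
    lay = layout (suc (suc m)) 0 0 0 0 (suc (suc (suc m))) (suc (suc m))
    valid : Layout.Valid lay
    valid = record { half = suc (suc m) ; odd = odd m ; large₁ = ≤-reflexive (sym (large₁ m)) ; large₂ = ≤-by 1 (large₂ m) }
      where
      odd : ∀ m → suc (suc (suc m)) + 0 + (suc (suc m) + 0) ≡ suc (2 * (suc (suc m)))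
      odd = solve-∀
      large₁ : ∀ m → suc (suc (suc (suc m) + (suc (suc m) + suc (suc (suc m)) + 0 + suc (suc m) + 0 + suc (suc m) + 0))) ≡ suc (suc (suc m) + suc (suc (suc m)) + 0 + suc (suc m) + 0 + suc (suc m) + 0 + suc (suc (suc m)) + 0)
      large₁ = solve-∀
      large₂ : ∀ m → suc (suc (suc (suc m) + suc (suc (suc m)) + 0 + (suc (suc m) + suc (suc (suc m)) + 0 + suc (suc m) + 0))) ≡ suc (suc (suc m) + suc (suc (suc m)) + 0 + suc (suc m) + 0 + suc (suc m) + 0 + suc (suc (suc m)) + 0) + 1
      large₂ = solve-∀
    open Family lay valid k b 7 [] [] ℓ≡ ↭-refl
    bound : ∀ m → 7 * m + 17 ≡ suc (suc m) + suc (suc (suc m)) + 0 + suc (suc m) + 0 + suc (suc m) + 0 + suc (suc (suc m)) + 0 + (2 * m + 5)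
    bound = solve-∀
    rung₁ : ∀ m → 7 * m + 17 ≡ suc (suc m) + (suc (suc m) + suc (suc (suc m)) + 0 + suc (suc m) + 0 + suc (suc m) + 0) + 2 * (suc (suc (suc m)))
    rung₁ = solve-∀
    rung₂ : ∀ m → 7 * m + 17 ≡ suc (suc m) + suc (suc (suc m)) + 0 + (suc (suc m) + suc (suc (suc m)) + 0 + suc (suc m) + 0) + 2 * (suc (suc m)) + 1
    rung₂ = solve-∀
    x-large₁ : ∀ k b → let m = 1 + (k + b + 7) in suc (2 * (7 * m + 17)) + 5 ≡ 14 * (k + b) + 90 + 2 * 31
    x-large₁ = solve-∀
    x-large₂ : ∀ k b → let m = 1 + (k + b + 7) in
      2 * (suc (suc m)) + (2 * 0 + k * (k + 3) + 7 * (2 * k + 2 * b + 7 + 3)) ≡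
      14 * (k + b) + 90 + 2 * (k + b) + k * (k + 3)
    x-large₂ = solve-∀
    x<y : ∀ k d → let b = 7 + k + d ; m = 1 + (k + b + 7) in
      2 * (b * (2 * k + b + 3)) + (0 * (2 * k + d) + 196) ≡
      2 * (2 * 0 + k * (k + 3) + 7 * (2 * k + 2 * b + 7 + 3)) + ((2 * k + d) * (2 * k + d) + (4 * d * k + d * d + 6 * d))
    x<y = solve-∀

-- Choice of the labeling for a given number of paths

halve : ∀ c → ∃ λ n → c ≡ n + n ⊎ c ≡ suc (n + n)
halve zero = 0 , inj₁ refl
halve (suc c) with halve c
... | n , inj₁ refl = n , inj₂ refl
... | n , inj₂ refl = suc n , inj₁ (cong suc (sym (+-suc n n)))

n+n≤m+m⇒n≤m : ∀ {n m} → n + n ≤ m + m → n ≤ m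
n+n≤m+m⇒n≤m n+n≤ = ≮⇒≥ λ m<n → <⇒≱ (+-mono-< m<n m<n) n+n≤

n+n<m+m⇒n<m : ∀ {n m} → n + n < m + m → n < m
n+n<m+m⇒n<m n+n< = ≰⇒> λ m≤n → <⇒≱ n+n< (+-mono-≤ m≤n m≤n)

bigStar-1 : ∀ b c → 37 ≤ b → c ≤ suc (suc b) + suc (suc b) → Labeling 1 b (suc c)
bigStar-1 (suc b) c 37≤b c≤ with halve c
-- `c` leaves out the path (1 , q), so an even `c` means an odd number of paths.
... | n , inj₁ refl = oneLeaf-odd (suc b) n (3 + (suc b)) (cong (3 +_) (sym (+-identityʳ (suc b)))) 37≤b
  (s≤s (n+n≤m+m⇒n≤m c≤))
... | n , inj₂ refl = oneLeaf-even b n (3 + b) (cong (3 +_) (sym (+-identityʳ b))) (≤-pred 37≤b)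
  (n+n<m+m⇒n<m c≤)

module BigStar (k d b m : ℕ) (b≡ : b ≡ 2 + k + d) (m≡ : m ≡ suc (2 + k + b)) (38≤a+b : 38 ≤ 2 + k + b) where

  private
    a+b≡ : ∀ k d → 2 + k + (2 + k + d) ≡ 4 + (2 * k + d)
    a+b≡ = solve-∀

  open TwoHoles k b d m b≡ (trans m≡ (cong (3 +_) (sym (+-identityʳ (k + b)))))
    (+-cancelˡ-≤ 4 34 (2 * k + d) (≤-trans (subst (λ b → 38 ≤ 2 + k + b) b≡ 38≤a+b) (≤-reflexive (a+b≡ k d)))) public

  bigStar-2+ : ∀ c → c ≤ m + m → Labeling (2 + k) b (suc c)
  bigStar-2+ c c≤ with halve c
  ... | n , inj₁ refl = twoHoles-odd n (n+n≤m+m⇒n≤m c≤)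
  ... | n , inj₂ refl = twoHoles-even n (<⇒≤ n<m) (≤-trans n<m (m≤m+n m k))
    where
    n<m : n < m
    n<m = n+n<m+m⇒n<m c≤

surplus-≤ : ∀ k b → surplus (7 + k) b ≤ 6
surplus-≤ (suc k) b = ≤-refl
surplus-≤ zero b with b ≤ᵇ 21
... | true  = n≤1+n 5
... | false = ≤-refl

-- There are 2m + 2 + j paths: j = 0 is the last case of two holes, n = m, and j = 1, ..., 4 are the
-- families with top labels. The first clauses dispose of the pairs k, j for which the surplus is
-- too small.
bigStar-surplus : ∀ k d j b m c → b ≡ 2 + k + d → m ≡ suc (2 + k + b) → c ≡ suc (m + m) + j →
  38 ≤ 2 + k + b → suc j < surplus (2 + k) b → Labeling (2 + k) b (suc c)
bigStar-surplus 0 d j b m c _ _ _ _ (s≤s ())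
bigStar-surplus 1 d (suc j) b m c _ _ _ _ (s≤s (s≤s ()))
bigStar-surplus 2 d (suc (suc j)) b m c _ _ _ _ (s≤s (s≤s (s≤s ())))
bigStar-surplus 3 d (suc (suc (suc j))) b m c _ _ _ _ (s≤s (s≤s (s≤s (s≤s ()))))
bigStar-surplus 4 d (suc (suc (suc (suc j)))) b m c _ _ _ _ (s≤s (s≤s (s≤s (s≤s (s≤s ())))))
bigStar-surplus (suc (suc (suc (suc (suc k))))) d (suc (suc (suc (suc (suc j))))) b m c _ _ _ _ j< =
  contradiction (≤-trans j< (surplus-≤ k b)) (<⇒≱ (m≤m+n 7 j))
bigStar-surplus (suc k) d 0 b m c b≡ m≡ c≡ large _ =
  subst (λ c → Labeling (3 + k) b (suc c)) (sym (trans c≡ (+-identityʳ (suc (m + m)))))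
    (BigStar.twoHoles-even (suc k) d b m b≡ m≡ large m ≤-refl
      (≤-trans (≤-reflexive (+-comm 1 m)) (+-monoʳ-≤ m (s≤s z≤n))))
bigStar-surplus (suc (suc k)) d 1 b m c b≡ m≡ c≡ large _ =
  subst (λ c → Labeling (4 + k) b (suc c)) (trans (paths m) (sym c≡))
    (TopLabels.topLabels-3 k b d m b≡ (trans (cong (λ m → suc m) m≡) (free k b)) (+-cancelˡ-≤ 4 34 (k + b) large)
      (+-cancelˡ-≤ 8 30 (2 * k + d) (≤-trans (subst (λ b → 38 ≤ 4 + k + b) b≡ large) (≤-reflexive (a+b≡ k d)))))
  where
  paths : ∀ m → suc m + suc m ≡ suc (m + m) + 1
  paths = solve-∀
  free : ∀ k b → suc (suc (4 + k + b)) ≡ 3 + (k + b + 3)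
  free = solve-∀
  a+b≡ : ∀ k d → 4 + k + (4 + k + d) ≡ 8 + (2 * k + d)
  a+b≡ = solve-∀
bigStar-surplus (suc (suc (suc k))) d 2 b m c b≡ m≡ c≡ large _ =
  subst (λ c → Labeling (5 + k) b (suc c)) (trans (paths m) (sym c≡))
    (TopLabels.topLabels-4 k b d m b≡ (trans (cong (λ m → suc m) m≡) (free k b)) (+-cancelˡ-≤ 5 33 (k + b) large)
      (+-cancelˡ-≤ 10 28 (2 * k + d) (≤-trans (subst (λ b → 38 ≤ 5 + k + b) b≡ large) (≤-reflexive (a+b≡ k d)))))
  where
  paths : ∀ m → suc (suc m) + suc m ≡ suc (m + m) + 2
  paths = solve-∀
  free : ∀ k b → suc (suc (5 + k + b)) ≡ 3 + (k + b + 4)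
  free = solve-∀
  a+b≡ : ∀ k d → 5 + k + (5 + k + d) ≡ 10 + (2 * k + d)
  a+b≡ = solve-∀
bigStar-surplus (suc (suc (suc (suc k)))) d 3 b m c b≡ m≡ c≡ large _ =
  subst (λ c → Labeling (6 + k) b (suc c)) (trans (paths m) (sym c≡))
    (TopLabels.topLabels-5 k b d m b≡ (trans (cong (λ m → suc m) m≡) (free k b)) (+-cancelˡ-≤ 6 32 (k + b) large)
      (+-cancelˡ-≤ 12 26 (2 * k + d) (≤-trans (subst (λ b → 38 ≤ 6 + k + b) b≡ large) (≤-reflexive (a+b≡ k d)))))
  where
  paths : ∀ m → suc (suc m) + suc (suc m) ≡ suc (m + m) + 3
  paths = solve-∀
  free : ∀ k b → suc (suc (6 + k + b)) ≡ 3 + (k + b + 5)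
  free = solve-∀
  a+b≡ : ∀ k d → 6 + k + (6 + k + d) ≡ 12 + (2 * k + d)
  a+b≡ = solve-∀
bigStar-surplus (suc (suc (suc (suc (suc k))))) d 4 b m c b≡ m≡ c≡ large _ =
  subst (λ c → Labeling (7 + k) b (suc c)) (trans (paths m) (sym c≡))
    (TopLabels.topLabels-6 k b d m b≡ (trans (cong (λ m → suc (suc m)) m≡) (free k b)) (+-cancelˡ-≤ 7 31 (k + b) large)
      (+-cancelˡ-≤ 14 24 (2 * k + d) (≤-trans (subst (λ b → 38 ≤ 7 + k + b) b≡ large) (≤-reflexive (a+b≡ k d)))))
  where
  paths : ∀ m → suc (suc (suc m)) + suc (suc m) ≡ suc (m + m) + 4
  paths = solve-∀
  free : ∀ k b → suc (suc (suc (7 + k + b))) ≡ 3 + (k + b + 7)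
  free = solve-∀
  a+b≡ : ∀ k d → 7 + k + (7 + k + d) ≡ 14 + (2 * k + d)
  a+b≡ = solve-∀

bigStar : ∀ a b m c → m ≡ suc (a + b) → 1 ≤ a → a ≤ b → 38 ≤ a + b → c < m + m + surplus a b → Labeling a b (suc c)
bigStar 1 b m c m≡ _ _ large c< = bigStar-1 b c (≤-pred large)
  (subst (λ m → c ≤ m + m) m≡ (≤-pred (subst (c <_) (+-comm (m + m) 1) c<)))
bigStar (suc (suc k)) b m c m≡ _ a≤b large c< with m≤n⇒∃[o]m+o≡n a≤b | c ≤? m + m
... | d , a+d≡b | yes c≤ = BigStar.bigStar-2+ k d b m (sym a+d≡b) m≡ large c c≤
... | d , a+d≡b | no  c≰ with m≤n⇒∃[o]m+o≡n (≰⇒> c≰)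
...   | j , c≡ = bigStar-surplus k d j b m c (sym a+d≡b) m≡ (sym c≡) large
  (+-cancelˡ-< (m + m) (suc j) (surplus (2 + k) b)
    (subst (_< m + m + surplus (2 + k) b) (trans (sym c≡) (sym (+-suc (m + m) j))) c<))

-- Without paths z cannot be the sum of a path centre. It is the greatest label instead, so both
-- star sums exceed every leaf, and A takes the smaller labels, whence x < y.
noPaths : ∀ a b → 1 ≤ a → a ≤ b → Labeling a b 0
noPaths a b 1≤a a≤b = record
  { z = z ; A = A ; B = B ; paths = []
  ; length-A = length-interval 0 a ; length-B = length-interval a b ; length-ps = refl
  ; labels = labels
  ; distinct = subst Unique (sym (++-identityʳ _))
      ((x≢y ∷ All.tabulate (λ l∈ → >⇒≢ (leaf< (sum A) l∈))) ∷ All.tabulate (λ l∈ → >⇒≢ (leaf< (sum B) l∈)) ∷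
       subst Unique (sym (interval-++ 0 a b)) (interval-unique 0 (a + b)))
  }
  where
  z = suc (a + b)
  A = interval 0 a
  B = interval a b
  labels : (z ∷ A ++ B) ++ [] ↭ interval 0 (suc (a + b) + 0)
  labels = begin
    (z ∷ A ++ B) ++ []                ≡⟨ ++-identityʳ (z ∷ A ++ B) ⟩
    z ∷ A ++ B                        ↭⟨ ++-comm (z ∷ []) (A ++ B) ⟩
    (A ++ B) ++ z ∷ []                ≡⟨ cong (_++ z ∷ []) (interval-++ 0 a b) ⟩
    interval 0 (a + b) ++ interval (a + b) 1 ≡⟨ interval-++ 0 (a + b) 1 ⟩
    interval 0 (a + b + 1)            ≡⟨ cong (interval 0) (trans (+-comm (a + b) 1) (sym (+-identityʳ z))) ⟩
    interval 0 (suc (a + b) + 0)      ∎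
    where open PermutationReasoning
  leaf< : ∀ s {l} → l ∈ A ++ B → l < z + s
  leaf< s l∈ = ≤-trans (s≤s (proj₂ (∈-interval⁻ 0 (a + b) (subst (_ ∈_) (interval-++ 0 a b) l∈)))) (m≤m+n z s)
  A<B : sum A < sum B
  A<B = *-cancelˡ-< 2 (sum A) (sum B) (subst₂ _<_ (sym (2*sum-interval 0 a)) (sym (2*sum-interval a b))
    (≤-<-trans (*-monoˡ-≤ (suc a) a≤b)
      (*-monoʳ-< b ⦃ >-nonZero (≤-trans 1≤a a≤b) ⦄ (≤-trans (s≤s (s≤s a≤b)) (+-monoˡ-≤ (suc b) (≤-trans 1≤a (m≤m+n a (a + 0))))))))
  x≢y : z + sum A ≢ z + sum B
  x≢y = <⇒≢ (+-monoʳ-< z A<B)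

-- Assembly of the cases

antimagic-≤ : ∀ a b i → 1 ≤ a → a ≤ b → surplus a b ≡ i →
  ∀ c → c ≤ tau0 (a + b + 1) ⊓ tauI (a + b + 1) i → Antimagic (DoubleStar a b ⊕ copies c P3)
antimagic-≤ a b i 1≤a a≤b _    zero    _  = labeling⇒antimagic (noPaths a b 1≤a a≤b)
antimagic-≤ a b i 1≤a a≤b refl (suc c) c≤ with a + b ≤? 37
... | yes a+b≤37 = labeling⇒antimagic (smallStar 1≤a a≤b a+b≤37
  (subst (λ m → suc c ≤ 2 * m + surplus a b) (+-comm (a + b) 1) (m≤n⊓o⇒m≤o (tau0 (a + b + 1)) _ c≤)) inner)
  where
  inner : InnerBound (suc (a + b)) (suc c)
  inner with m≤n⇒∃[o]m+o≡n 1≤a | m≤n⇒∃[o]m+o≡n (≤-trans 1≤a a≤b)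
  ... | a′ , refl | b′ , refl = subst (λ m → InnerBound m (suc c)) (sym (m≡ a′ b′))
    (≤tau0⇒innerBound (a′ + b′) (suc c) (subst (λ m → suc c ≤ tau0 m) (trans (+-comm (suc a′ + suc b′) 1) (m≡ a′ b′))
      (m≤n⊓o⇒m≤n (tau0 (suc a′ + suc b′ + 1)) _ c≤)))
    where
    m≡ : ∀ a b → suc (suc a + suc b) ≡ 3 + (a + b)
    m≡ = solve-∀
... | no  a+b≰37 = labeling⇒antimagic (bigStar a b (suc (a + b)) c refl 1≤a a≤b (≰⇒> a+b≰37)
  (subst (suc c ≤_) (cong (_+ surplus a b) (2*m a b)) (m≤n⊓o⇒m≤o (tau0 (a + b + 1)) _ c≤)))
  where
  2*m : ∀ a b → 2 * (a + b + 1) ≡ suc (a + b) + suc (a + b)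
  2*m = solve-∀

surplus-pred : ∀ a b → a ≤ 4 → surplus (2 + a) b ≡ suc a
surplus-pred 0 b _ = refl
surplus-pred 1 b _ = refl
surplus-pred 2 b _ = refl
surplus-pred 3 b _ = refl
surplus-pred 4 b _ = refl
surplus-pred (suc (suc (suc (suc (suc a))))) b (s≤s (s≤s (s≤s (s≤s ()))))

surplus-7-small : ∀ b → b ≤ 21 → surplus 7 b ≡ 5
surplus-7-small b b≤21 with b ≤ᵇ 21 | ≤⇒≤ᵇ b≤21
... | true | _ = refl

surplus-7-large : ∀ b → 22 ≤ b → surplus 7 b ≡ 6
surplus-7-large b 22≤b with b ≤ᵇ 21 in eq
... | false = refl
... | true  = contradiction (≤ᵇ⇒≤ b 21 (subst T (sym eq) _)) (<⇒≱ 22≤b)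

1≤a≤2⇒a≡1⊎a≡2 : ∀ {a} → 1 ≤ a → a ≤ 2 → a ≡ 1 ⊎ a ≡ 2
1≤a≤2⇒a≡1⊎a≡2 {1} _ _ = inj₁ refl
1≤a≤2⇒a≡1⊎a≡2 {2} _ _ = inj₂ refl
1≤a≤2⇒a≡1⊎a≡2 {suc (suc (suc a))} _ (s≤s (s≤s ()))

theorem2 : ∀ (a b : ℕ) → 1 ≤ a → a ≤ b →
    let m = a + b + 1 in
    (a ≤ 2 → TauIs (DoubleStar a b) (tau0 m ⊓ tauI m 1))
    × (2 ≤ a → a ≤ 6 → TauIs (DoubleStar a b) (tau0 m ⊓ tauI m (a ∸ 1)))
    × (a ≡ 7 → b ≤ 21 → TauIs (DoubleStar a b) (tau0 m ⊓ tauI m 5))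
    × ((a ≡ 7 × 22 ≤ b) ⊎ 8 ≤ a → TauIs (DoubleStar a b) (tau0 m ⊓ tauI m 6))
theorem2 a b 1≤a a≤b =
  (λ a≤2 → [ (λ a≡1 → small 1 (surplus-at a≡1) , notAntimagic-1 a b 1≤a 1≤b a≡1)
           -- a = 2 lies in the first two cases of the theorem; both give 2m + 1 as the second term.
           , (λ a≡2 → small 1 (surplus-at a≡2) , notAntimagic-2+ a b 1≤a 1≤b 1 0 refl a≡2) ]′ (1≤a≤2⇒a≡1⊎a≡2 1≤a a≤2)) ,
  (λ 2≤a a≤6 → let (k , 2+k≡a) = m≤n⇒∃[o]m+o≡n 2≤a in
    small (a ∸ 1) (subst (λ a → surplus a b ≡ a ∸ 1) 2+k≡a
      (surplus-pred k b (+-cancelˡ-≤ 2 k 4 (subst (_≤ 6) (sym 2+k≡a) a≤6)))) ,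
    notAntimagic-2+ a b 1≤a 1≤b (a ∸ 1) k (cong (_∸ 1) (sym 2+k≡a)) (sym 2+k≡a)) ,
  (λ a≡7 b≤21 → small 5 (trans (surplus-at a≡7) (surplus-7-small b b≤21)) , notAntimagic-7 a b 1≤a 1≤b a≡7 b≤21) ,
  (λ large → small 6 ([ (λ (a≡7 , 22≤b) → trans (surplus-at a≡7) (surplus-7-large b 22≤b))
                      , (λ 8≤a → let (k , 8+k≡a) = m≤n⇒∃[o]m+o≡n 8≤a in surplus-at (sym 8+k≡a)) ]′ large) ,
    notAntimagic-any a b 1≤a 1≤b)
  where
  1≤b : 1 ≤ b
  1≤b = ≤-trans 1≤a a≤b
  surplus-at : ∀ {a′} → a ≡ a′ → surplus a b ≡ surplus a′ b
  surplus-at = cong (λ a → surplus a b)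
  small : ∀ i → surplus a b ≡ i → ∀ c → c ≤ tau0 (a + b + 1) ⊓ tauI (a + b + 1) i →
    Antimagic (DoubleStar a b ⊕ copies c P3)
  small i = antimagic-≤ a b i 1≤a a≤b
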